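{- The algorithm $A(\epsilon)$ described in the context is an $$O\!\left(n \min\{\log n, \log(1/\epsilon)\} + \frac{1}{\epsilon^2} \log(1/\epsilon)\, \min\left\{n, \frac{1}{\epsilon}\log(1/\epsilon)\right\}\right)\text{ -time}$$ $(1+\epsilon)$-approximation for the three-machine proportionate mixed shop problem $M3 \mid prpt \mid C_{\max}$ when $p_1 \ge q_{\ell+1}$; that is, for any given $\epsilon>0$ it runs within this time bound and, on every instance with $p_1\ge q_{\ell+1}$, outputs a feasible schedule of makespan at most $(1+\epsilon)\,C^*_{\max}$.
   Context: Problem $M3 \mid prpt \mid C_{\max}$. There are three machines $M_1,M_2,M_3$ and a set $\mathcal{J}=\mathcal{F}\cup\mathcal{O}$ of $n$ jobs, with flow-shop jobs $\mathcal{F}=\{J_1,\dots,J_\ell\}$ and open-shop jobs $\mathcal{O}=\{J_{\ell+1},\dots,J_n\}$. Each $J_i\in\mathcal{F}$ must be processed non-preemptively on $M_1$, then $M_2$, then $M_3$, with processing time $p_i$ on each machine. Each $J_i\in\mathcal{O}$ must be processed non-preemptively on each of the three machines, in any machine order, with processing time $q_i$ on each machine. At every time a job is processed by at most one machine and a machine processes at most one job. The makespan is the maximum job completion time; it is to be minimized, and $C^*_{\max}$ is its minimum. Jobs are indexed so that $p_1\ge p_2\ge\dots\ge p_\ell$ and $q_{\ell+1}\ge q_{\ell+2}\ge\dots\ge q_n$. For $\mathcal{Y}\subseteq\mathcal{O}$, $Q(\mathcal{Y})=\sum_{J_i\in\mathcal{Y}}q_i$. Procedure Proc$(\mathcal{X},\mathcal{Y},\mathcal{F})$,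 for a bipartition $\{\mathcal{X},\mathcal{Y}\}$ of $\mathcal{O}$ (a part may be empty), produces the following schedule. The jobs within each of $\mathcal{F}$, $\mathcal{X}$, $\mathcal{Y}$ are processed in the same longest-processing-time-first (LPT) order on all three machines. Every job of $\mathcal{F}$ visits $M_1$, then $M_2$, then $M_3$; every job of $\mathcal{X}$ visits $M_2$, then $M_3$, then $M_1$; every job of $\mathcal{Y}$ visits $M_3$, then $M_1$, then $M_2$. Machine $M_1$ processes $\mathcal{F}$ first, then $\mathcal{Y}$, lastly $\mathcal{X}$; $M_2$ processes $\mathcal{X}$ first, then $\mathcal{F}$, lastly $\mathcal{Y}$; $M_3$ processes $\mathcal{Y}$ first, then $\mathcal{X}$, lastly $\mathcal{F}$. Each operation starts as early as these orders permit. Algorithm $A(\epsilon)$: (1) If $Q(\mathcal{O})\le p_1$, run Proc$(\mathcal{O},\emptyset,\mathcal{F})$, output the schedule produced, and stop. (2) Construct the Knapsack instance with one item for each $J_i\in\mathcal{O}$, of profit $q_i$ and size $q_i$, and knapsack capacity $p_1$. Run a $(1+\epsilon)$-approximation algorithm for Min-Knapsack (find a set of items of minimum total profit that cannot be packed into the knapsack) to obtain $\mathcal{A}\subseteq\mathcal{O}$; thus $p_1<Q(\mathcal{A})\le(1+\epsilon)\min\{Q(\mathcal{X}):\mathcal{X}\subseteq\mathcal{O},\,Q(\mathcal{X})>p_1\}$. Run Proc$(\mathcal{A},\mathcal{O}\setminus\mathcal{A},\mathcal{F})$ to construct a schedule $\pi^1$. (3) Run a $(1-\epsilon)$-approximation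 algorithm for Max-Knapsack (find a set of items of maximum total profit that can be packed into the knapsack) on the same instance to obtain $\mathcal{B}\subseteq\mathcal{O}$; thus $p_1\ge Q(\mathcal{B})\ge(1-\epsilon)\max\{Q(\mathcal{Y}):\mathcal{Y}\subseteq\mathcal{O},\,Q(\mathcal{Y})\le p_1\}$. Run Proc$(\mathcal{O}\setminus\mathcal{B},\mathcal{B},\mathcal{F})$ to construct a schedule $\pi^2$. (4) Output the schedule with the smaller makespan between $\pi^1$ and $\pi^2$. The Min-Knapsack and Max-Knapsack approximation algorithms used are known ones, each running in $O(n \min\{\log n, \log(1/\epsilon)\} + \frac{1}{\epsilon^2} \log(1/\epsilon) \min\{n, \frac{1}{\epsilon}\log(1/\epsilon)\})$ time.
   Formalization: The processing times, the accuracy ε and the start times of the schedules are taken to be rational numbers instead of real numbers. -}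

module Defs where

open import Data.Bool.Base using (if_then_else_)
open import Data.Fin.Base using (Fin)
open import Data.Fin.Patterns using (0F; 1F; 2F)
open import Data.Fin.Subset using (Subset; inside; outside; ⊤)
open import Data.Integer.Base using (+_; ∣_∣)
open import Data.Nat.Base as ℕ using (ℕ; zero; suc)
open import Data.Nat.Logarithm using (⌈log₂_⌉)
open import Data.Product.Base using (∃; _×_; _,_)
open import Data.Rational.Base
  using (ℚ; 0ℚ; 1ℚ; Positive; _/_; 1/_; _+_; _-_; _*_; _⊔_; _⊓_; _≤_; _≥_; _<_; ceiling)
open import Data.Rational.Properties using (_≤?_; pos⇒nonZero)
open import Data.Sum.Base using (_⊎_; inj₁; inj₂)
import Data.Unit.Base as Unit
open import Data.Vec.Base using (Vec; []; _∷_; head; lookup; map; replicate; tabulate; foldr′; _[_]≔_)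
open import Data.Vec.Relation.Unary.All using (All)
open import Data.Vec.Relation.Unary.Linked using (Linked)
open import Relation.Binary.PropositionalEquality.Core using (_≡_; _≢_)
open import Relation.Nullary.Decidable.Core using (Dec; does)

fromℕ : ℕ → ℚ
fromℕ k = + k / 1

------------------------------------------------------------------------
-- The problem M3 | prpt | C_max

Machine : Set
Machine = Fin 3

pattern M₁ = 0F
pattern M₂ = 1F
pattern M₃ = 2F

-- ℓ flow-shop jobs and m open-shop jobs; q is indexed from its own first
-- element, so the head of q is the longest open-shop job.
record Instance (ℓ m : ℕ) : Set where
  field
    p        : Vec ℚ ℓ
    q        : Vec ℚ m
    p-nonNeg : All (0ℚ ≤_) p
    q-nonNeg : All (0ℚ ≤_) q
    p-sorted : Linked _≥_ p
    q-sorted : Linked _≥_ q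

Job : ℕ → ℕ → Set
Job ℓ m = Fin ℓ ⊎ Fin m

-- For every job, the start times of its operations on M₁, M₂, M₃.
record Schedule (ℓ m : ℕ) : Set where
  constructor schedule
  field
    flowStarts : Vec (Vec ℚ 3) ℓ
    openStarts : Vec (Vec ℚ 3) m

module _ {ℓ m : ℕ} (I : Instance ℓ m) where
  open Instance I

  duration : Job ℓ m → ℚ
  duration (inj₁ i) = lookup p i
  duration (inj₂ i) = lookup q i

  module _ (σ : Schedule ℓ m) where
    open Schedule σ

    start : Job ℓ m → Machine → ℚ
    start (inj₁ i) M = lookup (lookup flowStarts i) M
    start (inj₂ i) M = lookup (lookup openStarts i) M

    end : Job ℓ m → Machine → ℚ
    end j M = start j M + duration j

    NoOverlap : Job ℓ m → Machine → Job ℓ m → Machine → Set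
    NoOverlap j M j′ M′ = end j M ≤ start j′ M′ ⊎ end j′ M′ ≤ start j M

    record Feasible : Set where
      field
        nonNegative : ∀ j M → 0ℚ ≤ start j M
        machines    : ∀ M j j′ → j ≢ j′ → NoOverlap j M j′ M
        jobs        : ∀ j M M′ → M ≢ M′ → NoOverlap j M j M′
        flowOrder   : ∀ i → end (inj₁ i) M₁ ≤ start (inj₁ i) M₂
                          × end (inj₁ i) M₂ ≤ start (inj₁ i) M₃

    completion : Job ℓ m → ℚ
    completion j = end j M₁ ⊔ (end j M₂ ⊔ end j M₃)

    makespan : ℚ
    makespan = foldr′ _⊔_ 0ℚ (tabulate λ i → completion (inj₁ i))
             ⊔ foldr′ _⊔_ 0ℚ (tabulate λ i → completion (inj₂ i))

  -- C is the value C*_max.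
  IsMinimumMakespan : ℚ → Set
  IsMinimumMakespan C = (∃ λ σ → Feasible σ × makespan σ ≡ C)
                      × (∀ σ → Feasible σ → C ≤ makespan σ)

  -- `within-any` is the guarantee without presupposing that the minimum
  -- is attained, so `within-minimum` does not hold vacuously.
  record IsApproximation (ρ : ℚ) (σ : Schedule ℓ m) : Set where
    field
      feasible       : Feasible σ
      within-minimum : ∀ C* → IsMinimumMakespan C* → makespan σ ≤ ρ * C*
      within-any     : ∀ τ → Feasible τ → makespan σ ≤ ρ * makespan τ

p₁ : ∀ {ℓ m} → Instance (suc ℓ) m → ℚ
p₁ I = head (Instance.p I)

HeadAtMost : ∀ {k} → ℚ → Vec ℚ k → Set
HeadAtMost c []      = Unit.⊤
HeadAtMost c (x ∷ _) = x ≤ c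

-- The condition p₁ ≥ q_{ℓ+1}, void when there are no open-shop jobs.
FlowDominant : ∀ {ℓ m} → Instance (suc ℓ) m → Set
FlowDominant I = HeadAtMost (p₁ I) (Instance.q I)

------------------------------------------------------------------------
-- Running time
--
-- Unit-cost model over ℚ: an addition, maximum, comparison, write, record
-- construction or step of a traversal costs 1; reading the fields of the
-- element at hand is part of such a step. `return` and `_>>=_` are free.

record Timed (A : Set) : Set where
  constructor _after_
  field
    value : A
    cost  : ℕ

open Timed public

infixl 1 _>>=_
infix  4 _≤ₜ_
infixl 6 _+ₜ_ _⊔ₜ_

return : {A : Set} → A → Timed A
return x = x after 0

_>>=_ : {A B : Set} → Timed A → (A → Timed B) → Timed B
t >>= f = value (f (value t)) after (cost t ℕ.+ cost (f (value t)))

step : {A : Set} → A → Timed A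
step x = x after 1

_+ₜ_ : ℚ → ℚ → Timed ℚ
x +ₜ y = step (x + y)

_⊔ₜ_ : ℚ → ℚ → Timed ℚ
x ⊔ₜ y = step (x ⊔ y)

_≤ₜ_ : (x y : ℚ) → Timed (Dec (x ≤ y))
x ≤ₜ y = step (x ≤? y)

mapₜ : {A B : Set} {k : ℕ} → (A → Timed B) → Vec A k → Timed (Vec B k)
mapₜ f []       = step []
mapₜ f (x ∷ xs) = do
  y  ← f x
  ys ← mapₜ f xs
  step (y ∷ ys)

zipWithₜ : {A B C : Set} {k : ℕ} →
           (A → B → Timed C) → Vec A k → Vec B k → Timed (Vec C k)
zipWithₜ f []       []       = step []
zipWithₜ f (x ∷ xs) (y ∷ ys) = do
  z  ← f x y
  zs ← zipWithₜ f xs ys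
  step (z ∷ zs)

foldₜ : {A B : Set} {k : ℕ} → (A → B → Timed B) → B → Vec A k → Timed B
foldₜ f e []       = step e
foldₜ f e (x ∷ xs) = do
  r ← foldₜ f e xs
  s ← f x r
  step s

-- max {1 , log₂ k}, rounded up; for log(1/ε) it is used with k = ⌈1/ε⌉,
-- which changes max {1 , log₂(1/ε)} by at most a constant factor.
-- Logarithms inside O(·) are bounded below by 1: otherwise n = 1, or ε
-- close to or above 1, would make the bound sublinear in n, zero or negative.
log : ℕ → ℕ
log k = 1 ℕ.⊔ ⌈log₂ k ⌉

-- n min{log n, log(1/ε)} + (1/ε²) log(1/ε) min{n, (1/ε) log(1/ε)}
timeBound : ℕ → (ε : ℚ) → .{{_ : Positive ε}} → ℚ
timeBound n ε = fromℕ (n ℕ.* (log n ℕ.⊓ L))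
              + 1/ε * 1/ε * fromℕ L * (fromℕ n ⊓ (1/ε * fromℕ L))
  where
  1/ε : ℚ
  1/ε = (1/ ε) {{pos⇒nonZero ε}}

  L : ℕ
  L = log ∣ ⌈ 1/ε ⌉ ∣

------------------------------------------------------------------------
-- Knapsack

record Item : Set where
  constructor item
  field
    profit size : ℚ

record Knapsack (m : ℕ) : Set where
  constructor knapsack
  field
    items    : Vec Item m
    capacity : ℚ

open Knapsack public using (capacity)

∑[_]_ : ∀ {m} → Subset m → Vec ℚ m → ℚ
∑[ []          ] []       = 0ℚ
∑[ inside  ∷ S ] (x ∷ xs) = x + ∑[ S ] xs
∑[ outside ∷ S ] (x ∷ xs) = ∑[ S ] xs

profit size : ∀ {m} → Knapsack m → Subset m → ℚ
profit K S = ∑[ S ] map Item.profit (Knapsack.items K)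
size   K S = ∑[ S ] map Item.size   (Knapsack.items K)

NonNegKnapsack : ∀ {m} → Knapsack m → Set
NonNegKnapsack K = All (λ i → 0ℚ ≤ Item.profit i × 0ℚ ≤ Item.size i) (Knapsack.items K)
                 × 0ℚ ≤ capacity K

KnapsackAlgorithm : Set
KnapsackAlgorithm = ∀ {m} → ℚ → Knapsack m → Timed (Subset m)

record IsMinKnapsackScheme (A : KnapsackAlgorithm) : Set where
  field
    unpackable   : ∀ ε .{{_ : Positive ε}} {m} (K : Knapsack m) →
                   NonNegKnapsack K → capacity K < size K ⊤ →
                   capacity K < size K (value (A ε K))
    near-minimum : ∀ ε .{{_ : Positive ε}} {m} (K : Knapsack m) →
                   NonNegKnapsack K → capacity K < size K ⊤ →
                   ∀ X → capacity K < size K X →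
                   profit K (value (A ε K)) ≤ (1ℚ + ε) * profit K X
    running-time : ∃ λ c → ∀ ε .{{_ : Positive ε}} {m} .{{_ : ℕ.NonZero m}} (K : Knapsack m) →
                   NonNegKnapsack K → capacity K < size K ⊤ →
                   fromℕ (cost (A ε K)) ≤ c * timeBound m ε

record IsMaxKnapsackScheme (A : KnapsackAlgorithm) : Set where
  field
    packable     : ∀ ε .{{_ : Positive ε}} {m} (K : Knapsack m) →
                   NonNegKnapsack K →
                   size K (value (A ε K)) ≤ capacity K
    near-maximum : ∀ ε .{{_ : Positive ε}} {m} (K : Knapsack m) →
                   NonNegKnapsack K →
                   ∀ Y → size K Y ≤ capacity K →
                   (1ℚ - ε) * profit K Y ≤ profit K (value (A ε K))
    running-time : ∃ λ c → ∀ ε .{{_ : Positive ε}} {m} .{{_ : ℕ.NonZero m}} (K : Knapsack m) →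
                   NonNegKnapsack K →
                   fromℕ (cost (A ε K)) ≤ c * timeBound m ε

------------------------------------------------------------------------
-- Procedure Proc

-- `done` is the completion time of the last operation scheduled so far.
record JobState : Set where
  constructor job
  field
    length : ℚ
    done   : ℚ
    starts : Vec ℚ 3

initₜ : ∀ {k} → Vec ℚ k → Timed (Vec JobState k)
initₜ = mapₜ λ d → step (job d 0ℚ (replicate 3 0ℚ))

-- Machine M, free from time t on, processes the jobs in S in the (LPT)
-- order of the vector. An operation starts at the later of the completion
-- of the preceding operation of its job and that of the preceding
-- operation on M. Also returns the time at which M becomes free.
run : ∀ {k} → Machine → Subset k → ℚ → Vec JobState k → Timed (ℚ × Vec JobState k)
run M []            t []                = step (t , [])
run M (outside ∷ S) t (j ∷ js)          = do
  (u , js′) ← run M S t js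
  step (u , j ∷ js′)
run M (inside ∷ S)  t (job d c s ∷ js)  = do
  b  ← t ⊔ₜ c
  e  ← b +ₜ d
  s′ ← step (s [ M ]≔ b)
  (u , js′) ← run M S e js
  step (u , job d e s′ ∷ js′)

-- Calls are ordered so that each comes after the preceding operations of
-- its jobs and after the preceding block on its machine: F visits
-- M₁ M₂ M₃, X visits M₂ M₃ M₁, Y visits M₃ M₁ M₂, while M₁ processes
-- F Y X, M₂ processes X F Y and M₃ processes Y X F.
Proc : ∀ {ℓ m} → Subset m → Subset m → Instance ℓ m → Timed (Schedule ℓ m)
Proc {ℓ} {m} X Y I = do
  F        ← mapₜ (λ _ → step inside) p
  fs       ← initₜ p
  os       ← initₜ q
  (a , fs) ← run M₁ F 0ℚ fs
  (b , os) ← run M₂ X 0ℚ os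
  (c , os) ← run M₃ Y 0ℚ os
  (b , fs) ← run M₂ F b fs
  (c , os) ← run M₃ X c os
  (a , os) ← run M₁ Y a os
  (c , fs) ← run M₃ F c fs
  (a , os) ← run M₁ X a os
  (b , os) ← run M₂ Y b os
  φ        ← mapₜ (λ j → step (JobState.starts j)) fs
  ω        ← mapₜ (λ j → step (JobState.starts j)) os
  step (schedule φ ω)
  where open Instance I

------------------------------------------------------------------------
-- Algorithm A(ε)

completionₜ : ℚ → Vec ℚ 3 → Timed ℚ
completionₜ d (s₁ ∷ s₂ ∷ s₃ ∷ []) = do
  e₁ ← s₁ +ₜ d
  e₂ ← s₂ +ₜ d
  e₃ ← s₃ +ₜ d
  e  ← e₂ ⊔ₜ e₃
  e₁ ⊔ₜ e

makespanₜ : ∀ {ℓ m} → Instance ℓ m → Schedule ℓ m → Timed ℚ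
makespanₜ I (schedule φ ω) = do
  cs ← zipWithₜ completionₜ p φ
  ds ← zipWithₜ completionₜ q ω
  c  ← foldₜ _⊔ₜ_ 0ℚ cs
  d  ← foldₜ _⊔ₜ_ 0ℚ ds
  c ⊔ₜ d
  where open Instance I

complementₜ : ∀ {m} → Subset m → Timed (Subset m)
complementₜ = mapₜ λ where
  inside  → step outside
  outside → step inside

module _ (minKnapsack maxKnapsack : KnapsackAlgorithm) (ε : ℚ)
         {ℓ m : ℕ} (I : Instance (suc ℓ) m) where
  open Instance I

  -- The case Q(O) ≤ p₁: Proc(O, ∅, F).
  oneSchedule : Timed (Schedule (suc ℓ) m)
  oneSchedule = do
    O ← mapₜ (λ _ → step inside) q
    ∅ ← complementₜ O
    Proc O ∅ I

  -- The case Q(O) > p₁: both knapsack schedules, then the shorter one.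
  betterOfTwo : Timed (Schedule (suc ℓ) m)
  betterOfTwo = do
    its ← mapₜ (λ x → step (item x x)) q
    K   ← step (knapsack its (p₁ I))
    A   ← minKnapsack ε K
    A′  ← complementₜ A
    π¹  ← Proc A A′ I
    B   ← maxKnapsack ε K
    B′  ← complementₜ B
    π²  ← Proc B′ B I
    C¹  ← makespanₜ I π¹
    C²  ← makespanₜ I π²
    le  ← C¹ ≤ₜ C²
    return (if does le then π¹ else π²)

  algorithmA : Timed (Schedule (suc ℓ) m)
  algorithmA = do
    Q  ← foldₜ _+ₜ_ 0ℚ q
    le ← Q ≤ₜ p₁ I
    if does le then oneSchedule else betterOfTwo

{-# OPTIONS --safe #-}

-- Write g(X, Y) = P + max(Q(X), p₁) + max(Q(Y), p₁), where P is the total length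
-- of the flow-shop jobs. When every job has length at most p₁, Proc(X, Y, F)
-- finishes by g(X, Y). Conversely, let X and Y be the open-shop jobs that a
-- feasible schedule processes on M₂ before and after J₁. Besides the flow-shop
-- jobs preceding J₁ on M₂, the time before J₁ starts on M₂ has to accommodate X
-- (on M₂), and likewise J₁ itself (on M₁), hence the larger of the two loads;
-- symmetrically for the time after J₁ ends on M₂, with Y and M₃. So the makespan
-- is at least g(X, Y), and it remains to minimise g over the bipartitions up to
-- a factor 1 + ε. If one part of the optimal bipartition has
-- load at most p₁, Max-Knapsack finds a part nearly as good; if both exceed p₁,
-- Min-Knapsack does; and if Q(O) ≤ p₁ then g is constant.
module Submission where

open import Data.Bool.Base using (if_then_else_)
open import Data.Empty using (⊥-elim)
open import Data.Fin.Base using (Fin; zero; suc)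
open import Data.Fin.Patterns using (0F)
open import Data.Fin.Properties using (suc-injective)
open import Data.Fin.Subset using (Subset; inside; outside; ⊤; ⊥; ∁; _∈_; _∉_)
open import Data.Fin.Subset.Properties using (∈⊤; ∉⊥; _∈?_; x∈p⇒x∉∁p; x∈∁p⇒x∉p; x∉p⇒x∈∁p)
import Data.Integer.Base as ℤ
import Data.Integer.Properties as ℤ
open import Data.Nat.Base as ℕ using (ℕ; suc; zero) renaming (_+_ to _+ℕ_)
open import Data.Nat.Logarithm using (⌈log₂_⌉; ⌈log₂⌉-mono-≤)
import Data.Nat.Properties as ℕ
open import Data.Nat.Tactic.RingSolver using (solve-∀)
open import Data.Product.Base using (∃; ∃₂; _×_; _,_; proj₁; proj₂)
open import Data.Rational.Base
  using (ℚ; 0ℚ; 1ℚ; Positive; NonNegative; nonNegative; toℚᵘ; 1/_; _+_; _-_; _*_; _⊔_; _⊓_; _≤_; _≥_; _<_; ceiling)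
open import Data.Rational.Properties
open import Data.Rational.Solver using (module +-*-Solver)
import Data.Rational.Unnormalised.Base as ℚᵘ
import Data.Rational.Unnormalised.Properties as ℚᵘ
open import Data.Sum.Base using (_⊎_; inj₁; inj₂; swap)
open import Data.Sum.Properties using (inj₁-injective; inj₂-injective)
open import Data.Vec.Base
  using (Vec; []; _∷_; here; there; lookup; head; tail; map; replicate; tabulate; foldr′; _[_]≔_)
open import Data.Vec.Properties using (lookup-map)
open import Data.Vec.Relation.Unary.All using (All; []; _∷_)
open import Data.Vec.Relation.Unary.All.Properties using (lookup⁺)
open import Data.Vec.Relation.Unary.Linked using (Linked)
open import Data.Vec.Relation.Unary.Linked.Properties using (Linked⇒All)
open import Function.Base using (_∘_; flip)
open import Relation.Binary.PropositionalEquality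
  using (_≡_; _≢_; refl; sym; trans; cong; cong₂; subst; subst₂)
open import Relation.Nullary.Decidable.Core using (Dec; yes; no; does)
open import Relation.Nullary.Negation using (¬_; contradiction)
open import Defs hiding (_after_)

open ≤-Reasoning using (begin_; step-≡-⟩; step-≡-⟨; step-≤; _∎)
open +-*-Solver using (solve; con; _:+_; _:*_; _:-_; _:=_)
open JobState using (length; done; starts)

-- Intervals in a window

-- The delicate part of the lower bound is the term p₁, because a feasible schedule may order the
-- flow-shop jobs differently on different machines: a job that precedes J₁ on M₂ may follow it on
-- M₁. Each side of J₁ is therefore divided once more, by the order on M₁ before J₁ and by the order
-- on M₃ after it, and the two groups turn out to occupy disjoint stretches of time. The length of
-- J₁ on M₂ itself is what completes P.
--
-- The upper bound traces no critical path. Each block of `Proc` gets a target time at which it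
-- could start working without idling; a block whose machine and jobs are on time ends on time, and
-- a job is at most D later for its next machine, where D = p₁ bounds every length.
--
-- Both bounds see a bipartition only through its two loads. The approximation argument is thus one
-- about rational numbers, made against every pair of loads with total Q(O) instead of a chosen
-- optimal one.

Apart : (s d s′ d′ : ℚ) → Set
Apart s d s′ d′ = s + d ≤ s′ ⊎ s′ + d′ ≤ s

-- `A` and `B` may hold together, as both sides of `Apart` can for an interval of length 0; the
-- split then settles on one of them, so that the two sums still add up to the whole.
record Split {k} (S : Subset k) (A B : Fin k → Set) : Set where
  field
    left right  : Subset k
    left-in     : ∀ {i} → i ∈ left → i ∈ S
    right-in    : ∀ {i} → i ∈ right → i ∈ S
    left-holds  : ∀ {i} → i ∈ left → A i
    right-holds : ∀ {i} → i ∈ right → B i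
    ∑-split     : ∀ d → ∑[ left ] d + ∑[ right ] d ≡ ∑[ S ] d

split : ∀ {k} {A B : Fin k → Set} (S : Subset k) →
        (∀ {i} → i ∈ S → A i ⊎ B i) → Split S A B
split [] _ = record
  { left = [] ; right = []
  ; left-in = λ () ; right-in = λ () ; left-holds = λ () ; right-holds = λ ()
  ; ∑-split = λ { [] → refl } }
split (outside ∷ S) f = record
  { left        = outside ∷ left
  ; right       = outside ∷ right
  ; left-in     = λ { (there i∈) → there (left-in i∈) }
  ; right-in    = λ { (there i∈) → there (right-in i∈) }
  ; left-holds  = λ { (there i∈) → left-holds i∈ }
  ; right-holds = λ { (there i∈) → right-holds i∈ }
  ; ∑-split     = λ { (_ ∷ d) → ∑-split d } }
  where open Split (split S (f ∘ there))
split (inside ∷ S) f with f here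
... | inj₁ a = record
  { left        = inside ∷ left
  ; right       = outside ∷ right
  ; left-in     = λ { here → here ; (there i∈) → there (left-in i∈) }
  ; right-in    = λ { (there i∈) → there (right-in i∈) }
  ; left-holds  = λ { here → a ; (there i∈) → left-holds i∈ }
  ; right-holds = λ { (there i∈) → right-holds i∈ }
  ; ∑-split     = λ { (x ∷ d) →
      trans (+-assoc x (∑[ left ] d) (∑[ right ] d)) (cong (x +_) (∑-split d)) } }
  where open Split (split S (f ∘ there))
... | inj₂ b = record
  { left        = outside ∷ left
  ; right       = inside ∷ right
  ; left-in     = λ { (there i∈) → there (left-in i∈) }
  ; right-in    = λ { here → here ; (there i∈) → there (right-in i∈) }
  ; left-holds  = λ { (there i∈) → left-holds i∈ }
  ; right-holds = λ { here → b ; (there i∈) → right-holds i∈ }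
  ; ∑-split     = λ { (x ∷ d) → trans
      (solve 3 (λ l y r → l :+ (y :+ r) := y :+ (l :+ r)) refl (∑[ left ] d) x (∑[ right ] d))
      (cong (x +_) (∑-split d)) } }
  where open Split (split S (f ∘ there))

swap-apart : ∀ {s d s′ d′} → Apart s d s′ d′ → Apart s′ d′ s d
swap-apart (inj₁ h) = inj₂ h
swap-apart (inj₂ h) = inj₁ h

-- Two families with separate index types, since flow-shop and open-shop jobs share a machine.
-- `lo≤hi` is all that remains when both families are empty.
record Packed {ℓ m} (S : Subset ℓ) (T : Subset m) (d : Vec ℚ ℓ) (e : Vec ℚ m)
              (s : Fin ℓ → ℚ) (r : Fin m → ℚ) (lo hi : ℚ) : Set where
  field
    lo≤hi   : lo ≤ hi
    window₁ : ∀ {i} → i ∈ S → lo ≤ s i × s i + lookup d i ≤ hi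
    window₂ : ∀ {i} → i ∈ T → lo ≤ r i × r i + lookup e i ≤ hi
    apart₁  : ∀ {i j} → i ∈ S → j ∈ S → i ≢ j → Apart (s i) (lookup d i) (s j) (lookup d j)
    apart₂  : ∀ {i j} → i ∈ T → j ∈ T → i ≢ j → Apart (r i) (lookup e i) (r j) (lookup e j)
    apart₁₂ : ∀ {i j} → i ∈ S → j ∈ T → Apart (s i) (lookup d i) (r j) (lookup e j)

-- The interval [a , a + x] cuts the window in two, and every packed interval
-- lies entirely on one side of the cut.
pack-around : ∀ {ℓ m} {S : Subset ℓ} {T : Subset m} {d e s r lo hi a x} →
  Packed S T d e s r lo hi → lo ≤ a → a + x ≤ hi →
  (∀ {i} → i ∈ S → Apart (s i) (lookup d i) a x) →
  (∀ {i} → i ∈ T → Apart (r i) (lookup e i) a x) →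
  (∀ S′ T′ {lo′ hi′} → Packed S′ T′ d e s r lo′ hi′ → lo′ + (∑[ S′ ] d + ∑[ T′ ] e) ≤ hi′) →
  lo + (x + (∑[ S ] d + ∑[ T ] e)) ≤ hi
pack-around {S = S} {T} {d} {e} {s} {r} {lo} {hi} {a} {x} w lo≤a a+x≤hi apartS apartT bound = begin
  lo + (x + (∑[ S ] d + ∑[ T ] e))
    ≡⟨ cong₂ (λ y z → lo + (x + (y + z))) (Split.∑-split cutS d) (Split.∑-split cutT e) ⟨
  lo + (x + ((l + l′) + (k + k′)))
    ≡⟨ solve 6 (λ a x l l′ k k′ → a :+ (x :+ ((l :+ l′) :+ (k :+ k′)))
                               := (a :+ (l :+ k)) :+ (x :+ (l′ :+ k′))) refl lo x l l′ k k′ ⟩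
  (lo + (l + k)) + (x + (l′ + k′))
    ≤⟨ +-monoˡ-≤ _ (bound (Split.left cutS) (Split.left cutT) below) ⟩
  a + (x + (l′ + k′))
    ≡⟨ +-assoc a x _ ⟨
  (a + x) + (l′ + k′)
    ≤⟨ bound (Split.right cutS) (Split.right cutT) above ⟩
  hi ∎
  where
  open Packed w
  cutS = split S apartS
  cutT = split T apartT
  l  = ∑[ Split.left cutS ] d
  l′ = ∑[ Split.right cutS ] d
  k  = ∑[ Split.left cutT ] e
  k′ = ∑[ Split.right cutT ] e
  below = record
    { lo≤hi   = lo≤a
    ; window₁ = λ i∈ → proj₁ (window₁ (Split.left-in cutS i∈)) , Split.left-holds cutS i∈
    ; window₂ = λ i∈ → proj₁ (window₂ (Split.left-in cutT i∈)) , Split.left-holds cutT i∈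
    ; apart₁  = λ i∈ j∈ → apart₁ (Split.left-in cutS i∈) (Split.left-in cutS j∈)
    ; apart₂  = λ i∈ j∈ → apart₂ (Split.left-in cutT i∈) (Split.left-in cutT j∈)
    ; apart₁₂ = λ i∈ j∈ → apart₁₂ (Split.left-in cutS i∈) (Split.left-in cutT j∈) }
  above = record
    { lo≤hi   = a+x≤hi
    ; window₁ = λ i∈ → Split.right-holds cutS i∈ , proj₂ (window₁ (Split.right-in cutS i∈))
    ; window₂ = λ i∈ → Split.right-holds cutT i∈ , proj₂ (window₂ (Split.right-in cutT i∈))
    ; apart₁  = λ i∈ j∈ → apart₁ (Split.right-in cutS i∈) (Split.right-in cutS j∈)
    ; apart₂  = λ i∈ j∈ → apart₂ (Split.right-in cutT i∈) (Split.right-in cutT j∈)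
    ; apart₁₂ = λ i∈ j∈ → apart₁₂ (Split.right-in cutS i∈) (Split.right-in cutT j∈) }

-- The recursion follows the index vectors instead of the order in time, which avoids sorting the
-- intervals. Removing the first interval leaves two windows, and the shorter vectors are used in
-- both of them, each time with a different subset; hence the generality in `S`, `T`, `lo` and `hi`.
pack : ∀ {ℓ m} (S : Subset ℓ) (T : Subset m) (d : Vec ℚ ℓ) (e : Vec ℚ m) {s r lo hi} →
       Packed S T d e s r lo hi → lo + (∑[ S ] d + ∑[ T ] e) ≤ hi
pack [] [] [] [] {lo = lo} w = ≤-trans (≤-reflexive (+-identityʳ lo)) (Packed.lo≤hi w)
pack [] (b ∷ T) [] (x ∷ e) {s} {r} {lo} {hi} w = by-head b w
  where
  rest : ∀ {b} → Packed [] (b ∷ T) [] (x ∷ e) s r lo hi → Packed [] T [] e s (r ∘ suc) lo hi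
  rest w = record
    { lo≤hi = lo≤hi ; window₁ = λ () ; window₂ = window₂ ∘ there ; apart₁ = λ ()
    ; apart₂ = λ i∈ j∈ i≢j → apart₂ (there i∈) (there j∈) (i≢j ∘ suc-injective)
    ; apart₁₂ = λ () }
    where open Packed w
  by-head : ∀ b → Packed [] (b ∷ T) [] (x ∷ e) s r lo hi → lo + (0ℚ + ∑[ b ∷ T ] (x ∷ e)) ≤ hi
  by-head outside w = pack [] T [] e (rest w)
  by-head inside  w = ≤-trans
    (≤-reflexive (cong (lo +_) (solve 3 (λ o x y → o :+ (x :+ y) := x :+ (o :+ y)) refl 0ℚ x _)))
    (pack-around (rest w) (proj₁ (window₂ here)) (proj₂ (window₂ here)) (λ ())
      (λ i∈ → apart₂ (there i∈) here λ ()) λ { [] T′ → pack [] T′ [] e })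
    where open Packed w
pack (b ∷ S) T (x ∷ d) e {s} {r} {lo} {hi} w = by-head b w
  where
  rest : ∀ {b} → Packed (b ∷ S) T (x ∷ d) e s r lo hi → Packed S T d e (s ∘ suc) r lo hi
  rest w = record
    { lo≤hi = lo≤hi ; window₁ = window₁ ∘ there ; window₂ = window₂
    ; apart₁ = λ i∈ j∈ i≢j → apart₁ (there i∈) (there j∈) (i≢j ∘ suc-injective)
    ; apart₂ = apart₂ ; apart₁₂ = apart₁₂ ∘ there }
    where open Packed w
  by-head : ∀ b → Packed (b ∷ S) T (x ∷ d) e s r lo hi → lo + (∑[ b ∷ S ] (x ∷ d) + ∑[ T ] e) ≤ hi
  by-head outside w = pack S T d e (rest w)
  by-head inside  w = ≤-trans
    (≤-reflexive (cong (lo +_) (+-assoc x _ _)))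
    (pack-around (rest w) (proj₁ (window₁ here)) (proj₂ (window₁ here))
      (λ i∈ → apart₁ (there i∈) here λ ())
      (λ j∈ → swap-apart (apart₁₂ here j∈)) λ S′ T′ → pack S′ T′ d e)
    where open Packed w

-- Lower bound for every feasible schedule

≤-maximum : ∀ {k} (f : Fin k → ℚ) i → f i ≤ foldr′ _⊔_ 0ℚ (tabulate f)
≤-maximum f zero    = p≤p⊔q _ _
≤-maximum f (suc i) = ≤-trans (≤-maximum (f ∘ suc) i) (p≤q⊔p (f zero) _)

maximum-≤ : ∀ {k} (f : Fin k → ℚ) {w} → 0ℚ ≤ w → (∀ i → f i ≤ w) → foldr′ _⊔_ 0ℚ (tabulate f) ≤ w
maximum-≤ {ℕ.zero} f 0≤w h = 0≤w
maximum-≤ {suc k}  f 0≤w h = ⊔-lub (h zero) (maximum-≤ (f ∘ suc) 0≤w (h ∘ suc))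

module _ {ℓ m} (I : Instance ℓ m) (σ : Schedule ℓ m) where

  completion≤makespan : ∀ j → completion I σ j ≤ makespan I σ
  completion≤makespan (inj₁ i) = ≤-trans (≤-maximum (completion I σ ∘ inj₁) i) (p≤p⊔q _ _)
  completion≤makespan (inj₂ i) = ≤-trans (≤-maximum (completion I σ ∘ inj₂) i)
    (p≤q⊔p (foldr′ _⊔_ 0ℚ (tabulate (completion I σ ∘ inj₁))) _)

  end≤makespan : ∀ j M → end I σ j M ≤ makespan I σ
  end≤makespan j M = ≤-trans (end≤completion M) (completion≤makespan j)
    where
    end≤completion : ∀ M → end I σ j M ≤ completion I σ j
    end≤completion M₁ = p≤p⊔q _ _
    end≤completion M₂ = ≤-trans (p≤p⊔q _ _) (p≤q⊔p (end I σ j M₁) _)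
    end≤completion M₃ = ≤-trans (p≤q⊔p (end I σ j M₂) _) (p≤q⊔p (end I σ j M₁) _)

  makespan≤ : ∀ {w} → 0ℚ ≤ w → (∀ j M → end I σ j M ≤ w) → makespan I σ ≤ w
  makespan≤ 0≤w h = ⊔-lub (maximum-≤ _ 0≤w (λ i → completion≤ (inj₁ i)))
                          (maximum-≤ _ 0≤w (λ i → completion≤ (inj₂ i)))
    where
    completion≤ : ∀ j → completion I σ j ≤ _
    completion≤ j = ⊔-lub (h j M₁) (⊔-lub (h j M₂) (h j M₃))

  duration-nonNeg : ∀ j → 0ℚ ≤ duration I j
  duration-nonNeg (inj₁ i) = lookup⁺ (Instance.p-nonNeg I) i
  duration-nonNeg (inj₂ i) = lookup⁺ (Instance.q-nonNeg I) i

p≤p+nonNeg : ∀ p {q} → 0ℚ ≤ q → p ≤ p + q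
p≤p+nonNeg p {q} 0≤q = ≤-trans (≤-reflexive (sym (+-identityʳ p))) (+-monoʳ-≤ p 0≤q)

-- For x = Q(X) and y = Q(Y): an upper bound for Proc on {X , Y}, and a lower bound
-- for the schedules in which X precedes and Y follows J₁ on M₂.
bipartitionBound : ∀ {ℓ m} → Instance (suc ℓ) m → ℚ → ℚ → ℚ
bipartitionBound I x y = ∑[ ⊤ ] Instance.p I + ((x ⊔ p₁ I) + (y ⊔ p₁ I))

∑-⊥ : ∀ {k} (d : Vec ℚ k) → ∑[ ⊥ ] d ≡ 0ℚ
∑-⊥ []      = refl
∑-⊥ (_ ∷ d) = ∑-⊥ d

∑⊤-uncons : ∀ {k} (d : Vec ℚ (suc k)) → ∑[ ⊤ ] d ≡ lookup d 0F + ∑[ ⊤ ] tail d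
∑⊤-uncons (_ ∷ _) = refl

head≡lookup : ∀ {k} (d : Vec ℚ (suc k)) → head d ≡ lookup d 0F
head≡lookup (_ ∷ _) = refl

lookup-tail : ∀ {k} (d : Vec ℚ (suc k)) i → lookup (tail d) i ≡ lookup d (suc i)
lookup-tail (_ ∷ _) i = refl

module LowerBound {ℓ m} (I : Instance (suc ℓ) m) (τ : Schedule (suc ℓ) m) (feasible : Feasible I τ) where
  open Instance I
  open Feasible feasible renaming (nonNegative to 0≤start)

  private
    flow : Fin ℓ → Job (suc ℓ) m
    flow i = inj₁ (suc i)

    J₁ : Job (suc ℓ) m
    J₁ = inj₁ 0F

    s e : Job (suc ℓ) m → Machine → ℚ
    s = start I τ
    e = end I τ

    C : ℚ
    C = makespan I τ

    s≤e : ∀ j M → s j M ≤ e j M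
    s≤e j M = p≤p+nonNeg (s j M) (duration-nonNeg I τ j)

    -- `F` and `O` divide the other jobs by their position relative to J₁ on M₂. `L` divides those
    -- in `F.left` again by their position on M₁, and `R` those in `F.right` by their position on
    -- M₃.
    onM₂-flow = split ⊤ λ {i} _ → machines M₂ (flow i) J₁ λ ()
    onM₂-open = split ⊤ λ {j} _ → machines M₂ (inj₂ j) J₁ λ ()
    module F = Split onM₂-flow
    module O = Split onM₂-open
    module L = Split (split F.left  λ {i} _ → machines M₁ (flow i) J₁ λ ())
    module R = Split (split F.right λ {i} _ → machines M₃ (flow i) J₁ λ ())

    flows : Vec ℚ ℓ
    flows = tail p

    lookup-flows : ∀ i → lookup flows i ≡ duration I (flow i)
    lookup-flows = lookup-tail p

    packed : ∀ M S T {lo hi} → lo ≤ hi →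
      (∀ {i} → i ∈ S → lo ≤ s (flow i) M × e (flow i) M ≤ hi) →
      (∀ {j} → j ∈ T → lo ≤ s (inj₂ j) M × e (inj₂ j) M ≤ hi) →
      lo + (∑[ S ] flows + ∑[ T ] q) ≤ hi
    packed M S T lo≤hi windowS windowT = pack S T flows q
      {s = λ i → s (flow i) M} {r = λ j → s (inj₂ j) M} record
      { lo≤hi   = lo≤hi
      ; window₁ = λ {i} i∈ → proj₁ (windowS i∈)
          , subst (λ d → s (flow i) M + d ≤ _) (sym (lookup-flows i)) (proj₂ (windowS i∈))
      ; window₂ = windowT
      ; apart₁  = λ {i} {j} _ _ i≢j →
          subst₂ (λ d e → Apart (s (flow i) M) d (s (flow j) M) e)
            (sym (lookup-flows i)) (sym (lookup-flows j))
            (machines M (flow i) (flow j) (i≢j ∘ suc-injective ∘ inj₁-injective))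
      ; apart₂  = λ {i} {j} _ _ i≢j → machines M (inj₂ i) (inj₂ j) (i≢j ∘ inj₂-injective)
      ; apart₁₂ = λ {i} {j} _ _ →
          subst (λ d → Apart (s (flow i) M) d (s (inj₂ j) M) (lookup q j)) (sym (lookup-flows i))
            (machines M (flow i) (inj₂ j) λ ())
      }

    packed-flow : ∀ M S {lo hi} → lo ≤ hi →
      (∀ {i} → i ∈ S → lo ≤ s (flow i) M × e (flow i) M ≤ hi) → lo + ∑[ S ] flows ≤ hi
    packed-flow M S {lo} {hi} lo≤hi window = subst (λ x → lo + x ≤ hi)
      (trans (cong (∑[ S ] flows +_) (∑-⊥ q)) (+-identityʳ _))
      (packed M S ⊥ lo≤hi window (⊥-elim ∘ ∉⊥))

    e₁≤s₂ : ∀ i → e (inj₁ i) M₁ ≤ s (inj₁ i) M₂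
    e₁≤s₂ i = proj₁ (flowOrder i)

    e₂≤s₃ : ∀ i → e (inj₁ i) M₂ ≤ s (inj₁ i) M₃
    e₂≤s₃ i = proj₂ (flowOrder i)

    x y before after p₁′ : ℚ
    x = ∑[ O.left ] q
    y = ∑[ O.right ] q
    before = ∑[ F.left ] flows
    after  = ∑[ F.right ] flows
    p₁′ = lookup p 0F

    before+x : before + x ≤ s J₁ M₂
    before+x = subst (_≤ s J₁ M₂) (+-identityˡ _)
      (packed M₂ F.left O.left (0≤start J₁ M₂)
        (λ {i} i∈ → 0≤start (flow i) M₂ , F.left-holds i∈)
        (λ {j} j∈ → 0≤start (inj₂ j) M₂ , O.left-holds j∈))

    after+y : e J₁ M₂ + (after + y) ≤ C
    after+y = packed M₂ F.right O.right (end≤makespan I τ J₁ M₂)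
      (λ {i} i∈ → F.right-holds i∈ , end≤makespan I τ (flow i) M₂)
      (λ {j} j∈ → O.right-holds j∈ , end≤makespan I τ (inj₂ j) M₂)

    -- The jobs of `L.left` precede J₁ on M₁, so they and J₁ fit there into the time up to
    -- `e J₁ M₁`. Those of `L.right` leave M₁ only after J₁ does, yet precede it on M₂, so their
    -- operations on M₂ lie between `e J₁ M₁` and `s J₁ M₂`.
    before+p₁ : before + p₁′ ≤ s J₁ M₂
    before+p₁ = begin
      before + p₁′                               ≡⟨ cong (_+ p₁′) (L.∑-split flows) ⟨
      (∑[ L.left ] flows + ∑[ L.right ] flows) + p₁′
        ≡⟨ solve 3 (λ a b c → (a :+ b) :+ c := (a :+ c) :+ b) refl
             (∑[ L.left ] flows) (∑[ L.right ] flows) p₁′ ⟩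
      (∑[ L.left ] flows + p₁′) + ∑[ L.right ] flows
        ≤⟨ +-monoˡ-≤ _ (+-monoˡ-≤ p₁′ (subst (_≤ s J₁ M₁) (+-identityˡ (∑[ L.left ] flows))
             (packed-flow M₁ L.left (0≤start J₁ M₁) λ {i} i∈ → 0≤start (flow i) M₁ , L.left-holds i∈))) ⟩
      e J₁ M₁ + ∑[ L.right ] flows
        ≤⟨ packed-flow M₂ L.right (e₁≤s₂ 0F) (λ {i} i∈ →
             ≤-trans (L.right-holds i∈) (≤-trans (s≤e (flow i) M₁) (e₁≤s₂ (suc i)))
             , F.left-holds (L.right-in i∈)) ⟩
      s J₁ M₂ ∎

    -- The mirror image of `before+p₁`: the jobs of `R.left` are processed on M₃ between the end of
    -- J₁ on M₂ and its start on M₃, and J₁ and then those of `R.right` follow on M₃.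
    after+p₁ : e J₁ M₂ + (after + p₁′) ≤ C
    after+p₁ = begin
      e J₁ M₂ + (after + p₁′)                     ≡⟨ cong (λ z → e J₁ M₂ + (z + p₁′)) (R.∑-split flows) ⟨
      e J₁ M₂ + ((∑[ R.left ] flows + ∑[ R.right ] flows) + p₁′)
        ≡⟨ solve 4 (λ z a b c → z :+ ((a :+ b) :+ c) := ((z :+ a) :+ c) :+ b) refl
             (e J₁ M₂) (∑[ R.left ] flows) (∑[ R.right ] flows) p₁′ ⟩
      ((e J₁ M₂ + ∑[ R.left ] flows) + p₁′) + ∑[ R.right ] flows
        ≤⟨ +-monoˡ-≤ _ (+-monoˡ-≤ p₁′ (packed-flow M₃ R.left (e₂≤s₃ 0F) λ {i} i∈ →
             ≤-trans (F.right-holds (R.left-in i∈)) (≤-trans (s≤e (flow i) M₂) (e₂≤s₃ (suc i)))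
             , R.left-holds i∈)) ⟩
      e J₁ M₃ + ∑[ R.right ] flows
        ≤⟨ packed-flow M₃ R.right (end≤makespan I τ J₁ M₃)
             (λ {i} i∈ → R.right-holds i∈ , end≤makespan I τ (flow i) M₃) ⟩
      C ∎

    max-case : ∀ a x y {z} → a + x ≤ z → a + y ≤ z → a + (x ⊔ y) ≤ z
    max-case a x y ax ay = ≤-trans (≤-reflexive (mono-≤-distrib-⊔ (+-monoʳ-≤ a) x y)) (⊔-lub ax ay)

    total : ∑[ ⊤ ] p ≡ p₁′ + (before + after)
    total = trans (∑⊤-uncons p) (cong (p₁′ +_) (sym (F.∑-split flows)))

  -- The makespan is cut at the start and the end of J₁ on M₂. Each outer piece has two lower bounds
  -- with a common summand, `before` or `after`, and so contains that summand plus a maximum. The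
  -- bipartition is recorded through the total of its loads, the form in which `Choice.choice` takes
  -- it.
  lower-bound : ∃₂ λ X Y → ∑[ X ] q + ∑[ Y ] q ≡ ∑[ ⊤ ] q
                × bipartitionBound I (∑[ X ] q) (∑[ Y ] q) ≤ makespan I τ
  lower-bound = O.left , O.right , O.∑-split q , (begin
    ∑[ ⊤ ] p + ((x ⊔ p₁ I) + (y ⊔ p₁ I))
      ≡⟨ cong₂ (λ P w → P + ((x ⊔ w) + (y ⊔ w))) total (head≡lookup p) ⟩
    (p₁′ + (before + after)) + ((x ⊔ p₁′) + (y ⊔ p₁′))
      ≡⟨ solve 5 (λ p b a x y → (p :+ (b :+ a)) :+ (x :+ y) := ((b :+ x) :+ p) :+ (a :+ y)) refl
           p₁′ before after (x ⊔ p₁′) (y ⊔ p₁′) ⟩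
    ((before + (x ⊔ p₁′)) + p₁′) + (after + (y ⊔ p₁′))
      ≤⟨ +-monoˡ-≤ _ (+-monoˡ-≤ p₁′ (max-case before x p₁′ before+x before+p₁)) ⟩
    e J₁ M₂ + (after + (y ⊔ p₁′))
      ≡⟨ +-assoc (e J₁ M₂) after _ ⟨
    (e J₁ M₂ + after) + (y ⊔ p₁′)
      ≤⟨ max-case (e J₁ M₂ + after) y p₁′
           (subst (_≤ C) (sym (+-assoc (e J₁ M₂) after y)) after+y)
           (subst (_≤ C) (sym (+-assoc (e J₁ M₂) after p₁′)) after+p₁) ⟩
    C ∎)

-- The schedule of Proc

loadBefore : ∀ {k} → Subset k → Vec ℚ k → Fin k → ℚ
loadBefore (_       ∷ S) (_ ∷ d) zero    = 0ℚ
loadBefore (inside  ∷ S) (x ∷ d) (suc i) = x + loadBefore S d i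
loadBefore (outside ∷ S) (_ ∷ d) (suc i) = loadBefore S d i

-- In punctual, readiness is measured against the time at which each job would
-- start if M worked without idling from w on. With all lengths at most D, that
-- holds on the next machine with w + D instead of w, so no LPT order is needed.
record Block {k} (M : Machine) (S : Subset k) (t : ℚ) (d : Vec ℚ k)
             (js : Vec JobState k) (r : ℚ × Vec JobState k) : Set where
  field
    at         : Fin k → ℚ
    free-start : ∀ {i} → i ∈ S → t ≤ at i
    job-ready  : ∀ {i} → i ∈ S → done (lookup js i) ≤ at i
    by-end     : ∀ {i} → i ∈ S → at i + lookup d i ≤ proj₁ r
    t≤end      : t ≤ proj₁ r
    apart      : ∀ {i j} → i ∈ S → j ∈ S → i ≢ j → Apart (at i) (lookup d i) (at j) (lookup d j)
    updated    : ∀ {i} → i ∈ S → lookup (proj₂ r) i ≡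
                 job (lookup d i) (at i + lookup d i) (starts (lookup js i) [ M ]≔ at i)
    untouched  : ∀ {i} → i ∉ S → lookup (proj₂ r) i ≡ lookup js i
    punctual   : ∀ {w} → t ≤ w → (∀ {i} → i ∈ S → done (lookup js i) ≤ w + loadBefore S d i) →
                 (∀ {i} → i ∈ S → at i ≤ w + loadBefore S d i) × proj₁ r ≤ w + ∑[ S ] d

  updated-from : ∀ {i l c s} → i ∈ S → lookup js i ≡ job l c s →
                 lookup (proj₂ r) i ≡ job (lookup d i) (at i + lookup d i) (s [ M ]≔ at i)
  updated-from {i} i∈S eq =
    trans (updated i∈S) (cong (λ j → job (lookup d i) (at i + lookup d i) (starts j [ M ]≔ at i)) eq)

  ready-from : ∀ {i l c s} → i ∈ S → lookup js i ≡ job l c s → c ≤ at i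
  ready-from {i} i∈S eq = subst (_≤ at i) (cong done eq) (job-ready i∈S)

run-block : ∀ {k} M (S : Subset k) t (d : Vec ℚ k) (js : Vec JobState k) →
            (∀ i → 0ℚ ≤ lookup d i) → (∀ i → length (lookup js i) ≡ lookup d i) →
            Block M S t d js (value (run M S t js))
run-block M [] t [] [] _ _ = record
  { at = λ () ; free-start = λ { {()} } ; job-ready = λ { {()} } ; by-end = λ { {()} }
  ; t≤end = ≤-refl ; apart = λ { {()} } ; updated = λ { {()} } ; untouched = λ { {()} }
  ; punctual = λ {w} t≤w _ → (λ { {()} }) , ≤-trans t≤w (≤-reflexive (sym (+-identityʳ w))) }
run-block M (outside ∷ S) t (x ∷ d) (j ∷ js) nonNeg len = record
  -- A dummy start for a job outside `S`; every field that speaks of `at i` assumes `i ∈ S`.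
  { at         = λ { zero → t ; (suc i) → at i }
  ; free-start = λ { (there i∈) → free-start i∈ }
  ; job-ready  = λ { (there i∈) → job-ready i∈ }
  ; by-end     = λ { (there i∈) → by-end i∈ }
  ; t≤end      = t≤end
  ; apart      = λ { (there i∈) (there j∈) i≢j → apart i∈ j∈ (i≢j ∘ cong suc) }
  ; updated    = λ { (there i∈) → updated i∈ }
  ; untouched  = λ { {zero} _ → refl ; {suc i} i∉ → untouched (i∉ ∘ there) }
  ; punctual   = λ t≤w ready → let b≤ , end≤ = punctual t≤w (ready ∘ there) in
                 (λ { (there i∈) → b≤ i∈ }) , end≤ }
  where open Block (run-block M S t d js (nonNeg ∘ suc) (len ∘ suc))
run-block M (inside ∷ S) t (x ∷ d) (job l c s ∷ js) nonNeg len with len zero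
... | refl = record
  { at         = λ { zero → b ; (suc i) → at i }
  ; free-start = λ { here → p≤p⊔q t c ; (there i∈) → ≤-trans t≤e (free-start i∈) }
  ; job-ready  = λ { here → p≤q⊔p t c ; (there i∈) → job-ready i∈ }
  ; by-end     = λ { here → t≤end ; (there i∈) → by-end i∈ }
  ; t≤end      = ≤-trans t≤e t≤end
  ; apart      = λ { here       here       i≢j → contradiction refl i≢j
                   ; here       (there j∈) i≢j → inj₁ (free-start j∈)
                   ; (there i∈) here       i≢j → inj₂ (free-start i∈)
                   ; (there i∈) (there j∈) i≢j → apart i∈ j∈ (i≢j ∘ cong suc) }
  ; updated    = λ { here → refl ; (there i∈) → updated i∈ }
  ; untouched  = λ { {zero} i∉ → contradiction here i∉ ; {suc i} i∉ → untouched (i∉ ∘ there) }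
  -- The first job starts by `w` and the load before each later job of `S` contains `x`, so the rest
  -- of the block is punctual with respect to `w + x`.
  ; punctual   = λ {w} t≤w ready →
      let b≤w = ⊔-lub t≤w (≤-trans (ready here) (≤-reflexive (+-identityʳ w)))
          b≤ , end≤ = punctual (+-monoˡ-≤ x b≤w)
            (λ i∈ → ≤-trans (ready (there i∈)) (≤-reflexive (sym (+-assoc w x _))))
      in (λ { here → ≤-trans b≤w (≤-reflexive (sym (+-identityʳ w)))
            ; (there i∈) → ≤-trans (b≤ i∈) (≤-reflexive (+-assoc w x _)) })
         , ≤-trans end≤ (≤-reflexive (+-assoc w x _)) }
  where
  b e : ℚ
  b = t ⊔ c
  e = b + x
  t≤e : t ≤ e
  t≤e = ≤-trans (p≤p⊔q t c) (p≤p+nonNeg b (nonNeg zero))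
  open Block (run-block M S e d js (nonNeg ∘ suc) (len ∘ suc))

-- Values of the timed traversals

mapₜ-step : ∀ {A B : Set} {k} (f : A → B) (xs : Vec A k) → value (mapₜ (step ∘ f) xs) ≡ map f xs
mapₜ-step f []       = refl
mapₜ-step f (x ∷ xs) = cong (f x ∷_) (mapₜ-step f xs)

mapₜ-inside : ∀ {A : Set} {k} (xs : Vec A k) → value (mapₜ (λ _ → step inside) xs) ≡ ⊤
mapₜ-inside []       = refl
mapₜ-inside (x ∷ xs) = cong (inside ∷_) (mapₜ-inside xs)

complementₜ-∁ : ∀ {k} (S : Subset k) → value (complementₜ S) ≡ ∁ S
complementₜ-∁ []            = refl
complementₜ-∁ (inside ∷ S)  = cong (outside ∷_) (complementₜ-∁ S)
complementₜ-∁ (outside ∷ S) = cong (inside ∷_) (complementₜ-∁ S)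

initial : ℚ → JobState
initial x = job x 0ℚ (replicate 3 0ℚ)

lookup-initₜ : ∀ {k} (d : Vec ℚ k) i → lookup (value (initₜ d)) i ≡ initial (lookup d i)
lookup-initₜ d i = trans (cong (λ js → lookup js i) (mapₜ-step initial d)) (lookup-map i initial d)

lookup-starts : ∀ {k v j} {js : Vec JobState k} {i} →
                v ≡ map starts js → lookup js i ≡ j → lookup v i ≡ starts j
lookup-starts {js = js} {i} refl eq = trans (lookup-map i starts js) (cong starts eq)

loadBefore-nonNeg : ∀ {k} (S : Subset k) (d : Vec ℚ k) →
                    (∀ i → 0ℚ ≤ lookup d i) → ∀ i → 0ℚ ≤ loadBefore S d i
loadBefore-nonNeg (_       ∷ S) (_ ∷ d) nonNeg zero    = ≤-refl
loadBefore-nonNeg (outside ∷ S) (_ ∷ d) nonNeg (suc i) = loadBefore-nonNeg S d (nonNeg ∘ suc) i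
loadBefore-nonNeg (inside  ∷ S) (x ∷ d) nonNeg (suc i) =
  +-mono-≤ (nonNeg zero) (loadBefore-nonNeg S d (nonNeg ∘ suc) i)

∑-nonNeg : ∀ {k} (S : Subset k) (d : Vec ℚ k) → (∀ i → 0ℚ ≤ lookup d i) → 0ℚ ≤ ∑[ S ] d
∑-nonNeg []            []      nonNeg = ≤-refl
∑-nonNeg (outside ∷ S) (_ ∷ d) nonNeg = ∑-nonNeg S d (nonNeg ∘ suc)
∑-nonNeg (inside  ∷ S) (x ∷ d) nonNeg = +-mono-≤ (nonNeg zero) (∑-nonNeg S d (nonNeg ∘ suc))

block-lengths : ∀ {k M S t d js r} → Block {k} M S t d js r →
                (∀ i → length (lookup js i) ≡ lookup d i) → ∀ i → length (lookup (proj₂ r) i) ≡ lookup d i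
block-lengths {S = S} b len i with i ∈? S
... | yes i∈ = cong length (Block.updated b i∈)
... | no  i∉ = trans (cong length (Block.untouched b i∉)) (len i)

-- Feasibility and makespan of the schedule

data Class : Set where
  𝓕 𝓧 𝓨 : Class

_≟ᶜ_ : (K K′ : Class) → Dec (K ≡ K′)
𝓕 ≟ᶜ 𝓕 = yes refl
𝓕 ≟ᶜ 𝓧 = no λ ()
𝓕 ≟ᶜ 𝓨 = no λ ()
𝓧 ≟ᶜ 𝓕 = no λ ()
𝓧 ≟ᶜ 𝓧 = yes refl
𝓧 ≟ᶜ 𝓨 = no λ ()
𝓨 ≟ᶜ 𝓕 = no λ ()
𝓨 ≟ᶜ 𝓧 = no λ ()
𝓨 ≟ᶜ 𝓨 = yes refl

-- The results of the nine runs are kept as variables: the nested calls of run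
-- that they stand for would blow up under normalisation.
record Runs {ℓ m} (X Y : Subset m) (I : Instance ℓ m) (σ : Schedule ℓ m) : Set where
  open Instance I
  field
    F   : Subset ℓ
    fs₀ : Vec JobState ℓ
    os₀ : Vec JobState m
    rF₁ rF₂ rF₃ : ℚ × Vec JobState ℓ
    rX₁ rX₂ rX₃ rY₁ rY₂ rY₃ : ℚ × Vec JobState m

    F≡⊤    : F ≡ ⊤
    init-F : ∀ i → lookup fs₀ i ≡ initial (lookup p i)
    init-O : ∀ i → lookup os₀ i ≡ initial (lookup q i)

    F₁ : Block M₁ F 0ℚ p fs₀ rF₁
    X₂ : Block M₂ X 0ℚ q os₀ rX₂
    Y₃ : Block M₃ Y 0ℚ q (proj₂ rX₂) rY₃
    F₂ : Block M₂ F (proj₁ rX₂) p (proj₂ rF₁) rF₂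
    X₃ : Block M₃ X (proj₁ rY₃) q (proj₂ rY₃) rX₃
    Y₁ : Block M₁ Y (proj₁ rF₁) q (proj₂ rX₃) rY₁
    F₃ : Block M₃ F (proj₁ rX₃) p (proj₂ rF₂) rF₃
    X₁ : Block M₁ X (proj₁ rY₁) q (proj₂ rY₁) rX₁
    Y₂ : Block M₂ Y (proj₁ rF₂) q (proj₂ rX₁) rY₂

    σ-flow : Schedule.flowStarts σ ≡ map starts (proj₂ rF₃)
    σ-open : Schedule.openStarts σ ≡ map starts (proj₂ rY₂)

proc-runs : ∀ {ℓ m} (X Y : Subset m) (I : Instance ℓ m) → Runs X Y I (value (Proc X Y I))
proc-runs {ℓ} {m} X Y I = record
  { F≡⊤    = mapₜ-inside p
  ; init-F = lookup-initₜ p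
  ; init-O = lookup-initₜ q
  ; F₁ = F₁ ; X₂ = X₂ ; Y₃ = Y₃ ; F₂ = F₂ ; X₃ = X₃ ; Y₁ = Y₁
  ; F₃ = run-block M₃ _ _ p _ nonNeg-p (block-lengths F₂ len-F₁)
  ; X₁ = X₁
  ; Y₂ = run-block M₂ Y _ q _ nonNeg-q (block-lengths X₁ len-Y₁)
  ; σ-flow = mapₜ-step starts _
  ; σ-open = mapₜ-step starts _
  }
  where
  open Instance I
  nonNeg-p : ∀ i → 0ℚ ≤ lookup p i
  nonNeg-p = lookup⁺ p-nonNeg
  nonNeg-q : ∀ i → 0ℚ ≤ lookup q i
  nonNeg-q = lookup⁺ q-nonNeg
  len-fs₀ : ∀ i → length (lookup (value (initₜ p)) i) ≡ lookup p i
  len-fs₀ i = cong length (lookup-initₜ p i)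
  len-os₀ : ∀ i → length (lookup (value (initₜ q)) i) ≡ lookup q i
  len-os₀ i = cong length (lookup-initₜ q i)
  F₁ = run-block M₁ (value (mapₜ (λ _ → step inside) p)) 0ℚ p _ nonNeg-p len-fs₀
  len-F₁ = block-lengths F₁ len-fs₀
  X₂ = run-block M₂ X 0ℚ q _ nonNeg-q len-os₀
  len-X₂ = block-lengths X₂ len-os₀
  Y₃ = run-block M₃ Y 0ℚ q _ nonNeg-q len-X₂
  len-Y₃ = block-lengths Y₃ len-X₂
  F₂ = run-block M₂ (value (mapₜ (λ _ → step inside) p)) _ p _ nonNeg-p len-F₁
  X₃ = run-block M₃ X _ q _ nonNeg-q len-Y₃
  len-X₃ = block-lengths X₃ len-Y₃
  Y₁ = run-block M₁ Y _ q _ nonNeg-q len-X₃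
  len-Y₁ = block-lengths Y₁ len-X₃
  X₁ = run-block M₁ X _ q _ nonNeg-q len-Y₁

module ProcSpec {ℓ m} (X Y : Subset m) (I : Instance ℓ m) (σ : Schedule ℓ m) (runs : Runs X Y I σ)
                (X∪Y : ∀ i → i ∈ X ⊎ i ∈ Y) (X∩Y : ∀ {i} → i ∈ X → i ∉ Y) where
  open Instance I
  open Runs runs

  Y∩X : ∀ {i} → i ∈ Y → i ∉ X
  Y∩X i∈Y i∈X = X∩Y i∈X i∈Y

  private
    nonNeg-p : ∀ i → 0ℚ ≤ lookup p i
    nonNeg-p = lookup⁺ p-nonNeg

    nonNeg-q : ∀ i → 0ℚ ≤ lookup q i
    nonNeg-q = lookup⁺ q-nonNeg

    module F₁ = Block F₁
    module F₂ = Block F₂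
    module F₃ = Block F₃
    module X₁ = Block X₁
    module X₂ = Block X₂
    module X₃ = Block X₃
    module Y₁ = Block Y₁
    module Y₂ = Block Y₂
    module Y₃ = Block Y₃

    ∈F : ∀ i → i ∈ F
    ∈F i = subst (i ∈_) (sym F≡⊤) ∈⊤

  module _ (i : Fin ℓ) where
    state-F₁ : lookup (proj₂ rF₁) i ≡ job (lookup p i) (F₁.at i + lookup p i) (F₁.at i ∷ 0ℚ ∷ 0ℚ ∷ [])
    state-F₁ = F₁.updated-from (∈F i) (init-F i)

    state-F₂ : lookup (proj₂ rF₂) i ≡ job (lookup p i) (F₂.at i + lookup p i) (F₁.at i ∷ F₂.at i ∷ 0ℚ ∷ [])
    state-F₂ = F₂.updated-from (∈F i) state-F₁

    state-F₃ : lookup (proj₂ rF₃) i ≡ job (lookup p i) (F₃.at i + lookup p i) (F₁.at i ∷ F₂.at i ∷ F₃.at i ∷ [])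
    state-F₃ = F₃.updated-from (∈F i) state-F₂

  -- In the states of an open-shop job, the run of the other open-shop class
  -- that follows in Proc is already included: it leaves the state unchanged.
  module _ {i : Fin m} (i∈X : i ∈ X) where
    private
      i∉Y : i ∉ Y
      i∉Y = X∩Y i∈X

    state-X₂ : lookup (proj₂ rY₃) i ≡ job (lookup q i) (X₂.at i + lookup q i) (0ℚ ∷ X₂.at i ∷ 0ℚ ∷ [])
    state-X₂ = trans (Y₃.untouched i∉Y) (X₂.updated-from i∈X (init-O i))

    state-X₃ : lookup (proj₂ rY₁) i ≡ job (lookup q i) (X₃.at i + lookup q i) (0ℚ ∷ X₂.at i ∷ X₃.at i ∷ [])
    state-X₃ = trans (Y₁.untouched i∉Y) (X₃.updated-from i∈X state-X₂)

    state-X₁ : lookup (proj₂ rY₂) i ≡ job (lookup q i) (X₁.at i + lookup q i) (X₁.at i ∷ X₂.at i ∷ X₃.at i ∷ [])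
    state-X₁ = trans (Y₂.untouched i∉Y) (X₁.updated-from i∈X state-X₃)

  module _ {i : Fin m} (i∈Y : i ∈ Y) where
    private
      i∉X : i ∉ X
      i∉X = Y∩X i∈Y

    state-Y₃ : lookup (proj₂ rX₃) i ≡ job (lookup q i) (Y₃.at i + lookup q i) (0ℚ ∷ 0ℚ ∷ Y₃.at i ∷ [])
    state-Y₃ = trans (X₃.untouched i∉X) (Y₃.updated-from i∈Y (trans (X₂.untouched i∉X) (init-O i)))

    state-Y₁ : lookup (proj₂ rX₁) i ≡ job (lookup q i) (Y₁.at i + lookup q i) (Y₁.at i ∷ 0ℚ ∷ Y₃.at i ∷ [])
    state-Y₁ = trans (X₁.untouched i∉X) (Y₁.updated-from i∈Y state-Y₃)

    state-Y₂ : lookup (proj₂ rY₂) i ≡ job (lookup q i) (Y₂.at i + lookup q i) (Y₁.at i ∷ Y₂.at i ∷ Y₃.at i ∷ [])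
    state-Y₂ = Y₂.updated-from i∈Y state-Y₁

  -- The class is an index, so two jobs of equal class leave only the three diagonal cases in
  -- `same-class`. The stored membership proofs are the arguments that the fields of `Block` expect.
  data InClass : Job ℓ m → Class → Set where
    in𝓕 : ∀ i → InClass (inj₁ i) 𝓕
    in𝓧 : ∀ {i} → i ∈ X → InClass (inj₂ i) 𝓧
    in𝓨 : ∀ {i} → i ∈ Y → InClass (inj₂ i) 𝓨

  class : ∀ j → ∃ (InClass j)
  class (inj₁ i) = 𝓕 , in𝓕 i
  class (inj₂ i) with X∪Y i
  ... | inj₁ i∈X = 𝓧 , in𝓧 i∈X
  ... | inj₂ i∈Y = 𝓨 , in𝓨 i∈Y

  private
    slots : ∀ {j K} → InClass j K → Vec ℚ 3
    slots (in𝓕 i)     = F₁.at i ∷ F₂.at i ∷ F₃.at i ∷ []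
    slots (in𝓧 {i} _) = X₁.at i ∷ X₂.at i ∷ X₃.at i ∷ []
    slots (in𝓨 {i} _) = Y₁.at i ∷ Y₂.at i ∷ Y₃.at i ∷ []

    start≡slot : ∀ {j K} (k : InClass j K) M → start I σ j M ≡ lookup (slots k) M
    start≡slot (in𝓕 i) M = cong (λ v → lookup v M) (lookup-starts σ-flow (state-F₃ i))
    start≡slot (in𝓧 {i} i∈X) M = cong (λ v → lookup v M) (lookup-starts σ-open (state-X₁ i∈X))
    start≡slot (in𝓨 {i} i∈Y) M = cong (λ v → lookup v M) (lookup-starts σ-open (state-Y₂ i∈Y))

    -- For each machine the clauses follow the order of its blocks. Consecutive blocks share an
    -- endpoint, and the first and last are separated by the middle block; this is all that
    -- `other-class` has to check.
    lo hi : Machine → Class → ℚ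
    lo M₁ 𝓕 = 0ℚ
    lo M₁ 𝓨 = proj₁ rF₁
    lo M₁ 𝓧 = proj₁ rY₁
    lo M₂ 𝓧 = 0ℚ
    lo M₂ 𝓕 = proj₁ rX₂
    lo M₂ 𝓨 = proj₁ rF₂
    lo M₃ 𝓨 = 0ℚ
    lo M₃ 𝓧 = proj₁ rY₃
    lo M₃ 𝓕 = proj₁ rX₃
    hi M₁ 𝓕 = proj₁ rF₁
    hi M₁ 𝓨 = proj₁ rY₁
    hi M₁ 𝓧 = proj₁ rX₁
    hi M₂ 𝓧 = proj₁ rX₂
    hi M₂ 𝓕 = proj₁ rF₂
    hi M₂ 𝓨 = proj₁ rY₂
    hi M₃ 𝓨 = proj₁ rY₃
    hi M₃ 𝓧 = proj₁ rX₃
    hi M₃ 𝓕 = proj₁ rF₃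

    window : ∀ {j K} (k : InClass j K) M →
             lo M K ≤ lookup (slots k) M × lookup (slots k) M + duration I j ≤ hi M K
    window (in𝓕 i) M₁ = F₁.free-start (∈F i) , F₁.by-end (∈F i)
    window (in𝓕 i) M₂ = F₂.free-start (∈F i) , F₂.by-end (∈F i)
    window (in𝓕 i) M₃ = F₃.free-start (∈F i) , F₃.by-end (∈F i)
    window (in𝓧 i∈) M₁ = X₁.free-start i∈ , X₁.by-end i∈
    window (in𝓧 i∈) M₂ = X₂.free-start i∈ , X₂.by-end i∈
    window (in𝓧 i∈) M₃ = X₃.free-start i∈ , X₃.by-end i∈
    window (in𝓨 i∈) M₁ = Y₁.free-start i∈ , Y₁.by-end i∈
    window (in𝓨 i∈) M₂ = Y₂.free-start i∈ , Y₂.by-end i∈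
    window (in𝓨 i∈) M₃ = Y₃.free-start i∈ , Y₃.by-end i∈

    same-class : ∀ {j j′ K} (k : InClass j K) (k′ : InClass j′ K) → j ≢ j′ → ∀ M →
      Apart (lookup (slots k) M) (duration I j) (lookup (slots k′) M) (duration I j′)
    same-class (in𝓕 i) (in𝓕 j) i≢j M₁ = F₁.apart (∈F i) (∈F j) (i≢j ∘ cong inj₁)
    same-class (in𝓕 i) (in𝓕 j) i≢j M₂ = F₂.apart (∈F i) (∈F j) (i≢j ∘ cong inj₁)
    same-class (in𝓕 i) (in𝓕 j) i≢j M₃ = F₃.apart (∈F i) (∈F j) (i≢j ∘ cong inj₁)
    same-class (in𝓧 i∈) (in𝓧 j∈) i≢j M₁ = X₁.apart i∈ j∈ (i≢j ∘ cong inj₂)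
    same-class (in𝓧 i∈) (in𝓧 j∈) i≢j M₂ = X₂.apart i∈ j∈ (i≢j ∘ cong inj₂)
    same-class (in𝓧 i∈) (in𝓧 j∈) i≢j M₃ = X₃.apart i∈ j∈ (i≢j ∘ cong inj₂)
    same-class (in𝓨 i∈) (in𝓨 j∈) i≢j M₁ = Y₁.apart i∈ j∈ (i≢j ∘ cong inj₂)
    same-class (in𝓨 i∈) (in𝓨 j∈) i≢j M₂ = Y₂.apart i∈ j∈ (i≢j ∘ cong inj₂)
    same-class (in𝓨 i∈) (in𝓨 j∈) i≢j M₃ = Y₃.apart i∈ j∈ (i≢j ∘ cong inj₂)

    other-class : ∀ M K K′ → K ≢ K′ → hi M K ≤ lo M K′ ⊎ hi M K′ ≤ lo M K
    other-class _  𝓕 𝓕 K≢K = contradiction refl K≢K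
    other-class _  𝓧 𝓧 K≢K = contradiction refl K≢K
    other-class _  𝓨 𝓨 K≢K = contradiction refl K≢K
    other-class M₁ 𝓕 𝓨 _ = inj₁ ≤-refl
    other-class M₁ 𝓨 𝓧 _ = inj₁ ≤-refl
    other-class M₁ 𝓕 𝓧 _ = inj₁ Y₁.t≤end
    other-class M₁ 𝓨 𝓕 _ = inj₂ ≤-refl
    other-class M₁ 𝓧 𝓨 _ = inj₂ ≤-refl
    other-class M₁ 𝓧 𝓕 _ = inj₂ Y₁.t≤end
    other-class M₂ 𝓧 𝓕 _ = inj₁ ≤-refl
    other-class M₂ 𝓕 𝓨 _ = inj₁ ≤-refl
    other-class M₂ 𝓧 𝓨 _ = inj₁ F₂.t≤end
    other-class M₂ 𝓕 𝓧 _ = inj₂ ≤-refl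
    other-class M₂ 𝓨 𝓕 _ = inj₂ ≤-refl
    other-class M₂ 𝓨 𝓧 _ = inj₂ F₂.t≤end
    other-class M₃ 𝓨 𝓧 _ = inj₁ ≤-refl
    other-class M₃ 𝓧 𝓕 _ = inj₁ ≤-refl
    other-class M₃ 𝓨 𝓕 _ = inj₁ X₃.t≤end
    other-class M₃ 𝓧 𝓨 _ = inj₂ ≤-refl
    other-class M₃ 𝓕 𝓧 _ = inj₂ ≤-refl
    other-class M₃ 𝓕 𝓨 _ = inj₂ X₃.t≤end

    apart-on : ∀ {j j′ K K′} (k : InClass j K) (k′ : InClass j′ K′) → j ≢ j′ → ∀ M →
      Apart (lookup (slots k) M) (duration I j) (lookup (slots k′) M) (duration I j′)
    apart-on {K = K} {K′} k k′ j≢j′ M with K ≟ᶜ K′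
    ... | yes refl = same-class k k′ j≢j′ M
    ... | no  K≢K′ with other-class M K K′ K≢K′
    ...   | inj₁ h = inj₁ (≤-trans (proj₂ (window k M)) (≤-trans h (proj₁ (window k′ M))))
    ...   | inj₂ h = inj₂ (≤-trans (proj₂ (window k′ M)) (≤-trans h (proj₁ (window k M))))

    F-order : ∀ i → F₁.at i + lookup p i ≤ F₂.at i × F₂.at i + lookup p i ≤ F₃.at i
    F-order i = F₂.ready-from (∈F i) (state-F₁ i) , F₃.ready-from (∈F i) (state-F₂ i)

    X-order : ∀ {i} → i ∈ X → X₂.at i + lookup q i ≤ X₃.at i × X₃.at i + lookup q i ≤ X₁.at i
    X-order i∈ = X₃.ready-from i∈ (state-X₂ i∈) , X₁.ready-from i∈ (state-X₃ i∈)

    Y-order : ∀ {i} → i ∈ Y → Y₃.at i + lookup q i ≤ Y₁.at i × Y₁.at i + lookup q i ≤ Y₂.at i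
    Y-order i∈ = Y₁.ready-from i∈ (state-Y₃ i∈) , Y₂.ready-from i∈ (state-Y₁ i∈)

    pairwise : ∀ (v : Vec ℚ 3) {d} (let s = lookup v) →
      Apart (s M₁) d (s M₂) d → Apart (s M₂) d (s M₃) d → Apart (s M₁) d (s M₃) d →
      ∀ M M′ → M ≢ M′ → Apart (s M) d (s M′) d
    pairwise v a b c M₁ M₁ M≢M = contradiction refl M≢M
    pairwise v a b c M₂ M₂ M≢M = contradiction refl M≢M
    pairwise v a b c M₃ M₃ M≢M = contradiction refl M≢M
    pairwise v a b c M₁ M₂ _ = a
    pairwise v a b c M₂ M₃ _ = b
    pairwise v a b c M₁ M₃ _ = c
    pairwise v a b c M₂ M₁ _ = swap-apart a
    pairwise v a b c M₃ M₂ _ = swap-apart b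
    pairwise v a b c M₃ M₁ _ = swap-apart c

    in-turn : ∀ s {s′ s″ d} → 0ℚ ≤ d → s + d ≤ s′ → s′ + d ≤ s″ → s + d ≤ s″
    in-turn s {s′} 0≤d h h′ = ≤-trans h (≤-trans (p≤p+nonNeg s′ 0≤d) h′)

    within-job : ∀ {j K} (k : InClass j K) M M′ → M ≢ M′ →
      Apart (lookup (slots k) M) (duration I j) (lookup (slots k) M′) (duration I j)
    within-job k@(in𝓕 i) with F-order i
    ... | h , h′ = pairwise (slots k) (inj₁ h) (inj₁ h′) (inj₁ (in-turn (F₁.at i) (nonNeg-p i) h h′))
    within-job k@(in𝓧 {i} i∈) with X-order i∈
    ... | h , h′ = pairwise (slots k) (inj₂ (in-turn (X₂.at i) (nonNeg-q i) h h′)) (inj₁ h) (inj₂ h′)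
    within-job k@(in𝓨 {i} i∈) with Y-order i∈
    ... | h , h′ = pairwise (slots k) (inj₁ h′) (inj₂ (in-turn (Y₃.at i) (nonNeg-q i) h h′)) (inj₂ h)

    0≤lo : ∀ M K → 0ℚ ≤ lo M K
    0≤lo M₁ 𝓕 = ≤-refl
    0≤lo M₁ 𝓨 = F₁.t≤end
    0≤lo M₁ 𝓧 = ≤-trans F₁.t≤end Y₁.t≤end
    0≤lo M₂ 𝓧 = ≤-refl
    0≤lo M₂ 𝓕 = X₂.t≤end
    0≤lo M₂ 𝓨 = ≤-trans X₂.t≤end F₂.t≤end
    0≤lo M₃ 𝓨 = ≤-refl
    0≤lo M₃ 𝓧 = Y₃.t≤end
    0≤lo M₃ 𝓕 = ≤-trans Y₃.t≤end X₃.t≤end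

  feasible : Feasible I σ
  feasible = record
    { nonNegative = λ j M → let K , k = class j in
        subst (0ℚ ≤_) (sym (start≡slot k M)) (≤-trans (0≤lo M K) (proj₁ (window k M)))
    ; machines    = λ M j j′ j≢j′ → let _ , k = class j ; _ , k′ = class j′ in
        subst₂ (λ s s′ → Apart s (duration I j) s′ (duration I j′))
          (sym (start≡slot k M)) (sym (start≡slot k′ M)) (apart-on k k′ j≢j′ M)
    ; jobs        = λ j M M′ M≢M′ → let _ , k = class j in
        subst₂ (λ s s′ → Apart s (duration I j) s′ (duration I j))
          (sym (start≡slot k M)) (sym (start≡slot k M′)) (within-job k M M′ M≢M′)
    ; flowOrder   = λ i → let h , h′ = F-order i ; start≡ = λ M → sym (start≡slot (in𝓕 i) M) in
        subst₂ (λ s s′ → s + lookup p i ≤ s′) (start≡ M₁) (start≡ M₂) h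
        , subst₂ (λ s s′ → s + lookup p i ≤ s′) (start≡ M₂) (start≡ M₃) h′
    }

  -- The targets at which `punctual` is applied, with `x` and `y` the maxima below: for F they are 0
  -- on M₁, `x` on M₂, `x + y` on M₃; for X, 0 on M₂, `y` on M₃, `P + y` on M₁; for Y, 0 on M₃, `P`
  -- on M₁, `P + x` on M₂. Successive targets of a class differ by `x`, `y` or `P`, hence by at
  -- least `D`, so the jobs are ready. Each target is also at least the bound on the end of the
  -- preceding block on the same machine.
  module _ {D : ℚ} (p≤D : ∀ i → lookup p i ≤ D) (q≤D : ∀ i → lookup q i ≤ D)
           (D≤P : D ≤ ∑[ ⊤ ] p) where
    private
      P x y : ℚ
      P = ∑[ ⊤ ] p
      x = ∑[ X ] q ⊔ D
      y = ∑[ Y ] q ⊔ D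

      D≤x : D ≤ x
      D≤x = p≤q⊔p (∑[ X ] q) D
      D≤y : D ≤ y
      D≤y = p≤q⊔p (∑[ Y ] q) D

      0+_ : ∀ {a b} → a ≤ b → 0ℚ + a ≤ b
      0+_ {a} = ≤-trans (≤-reflexive (+-identityˡ a))

      -- Passing to the next machine: `β` is the load before the job in its block. It is the same on
      -- both machines, so only the target has to grow, by `D`.
      over : ∀ w {w′ s d β} → s ≤ w + β → d ≤ D → w + D ≤ w′ → s + d ≤ w′ + β
      over w {w′} {s} {d} {β} s≤ d≤D w+D≤w′ = begin
        s + d        ≤⟨ +-mono-≤ s≤ d≤D ⟩
        (w + β) + D  ≡⟨ solve 3 (λ w b d → (w :+ b) :+ d := (w :+ d) :+ b) refl w β D ⟩
        (w + D) + β  ≤⟨ +-monoˡ-≤ β w+D≤w′ ⟩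
        w′ + β       ∎

      idle-fs₀ : ∀ {i} → i ∈ F → done (lookup fs₀ i) ≤ 0ℚ + loadBefore F p i
      idle-fs₀ {i} _ = subst (_≤ 0ℚ + loadBefore F p i) (sym (cong done (init-F i)))
        (+-mono-≤ ≤-refl (loadBefore-nonNeg F p nonNeg-p i))

      sum-F : ∑[ F ] p ≡ P
      sum-F = cong (λ S → ∑[ S ] p) F≡⊤

      at-F₁ : (∀ {i} → i ∈ F → F₁.at i ≤ 0ℚ + loadBefore F p i) × proj₁ rF₁ ≤ 0ℚ + ∑[ F ] p
      at-F₁ = F₁.punctual ≤-refl idle-fs₀

      at-X₂ : (∀ {i} → i ∈ X → X₂.at i ≤ 0ℚ + loadBefore X q i) × proj₁ rX₂ ≤ 0ℚ + ∑[ X ] q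
      at-X₂ = X₂.punctual ≤-refl λ {i} _ → subst (_≤ 0ℚ + loadBefore X q i)
        (sym (cong done (init-O i))) (+-mono-≤ ≤-refl (loadBefore-nonNeg X q nonNeg-q i))

      at-Y₃ : (∀ {i} → i ∈ Y → Y₃.at i ≤ 0ℚ + loadBefore Y q i) × proj₁ rY₃ ≤ 0ℚ + ∑[ Y ] q
      at-Y₃ = Y₃.punctual ≤-refl λ {i} i∈ → subst (_≤ 0ℚ + loadBefore Y q i)
        (sym (cong done (trans (X₂.untouched (Y∩X i∈)) (init-O i))))
        (+-mono-≤ ≤-refl (loadBefore-nonNeg Y q nonNeg-q i))

      at-F₂ : (∀ {i} → i ∈ F → F₂.at i ≤ x + loadBefore F p i) × proj₁ rF₂ ≤ x + ∑[ F ] p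
      at-F₂ = F₂.punctual (≤-trans (proj₂ at-X₂) (0+ p≤p⊔q (∑[ X ] q) D))
        λ {i} i∈ → subst (_≤ x + loadBefore F p i) (sym (cong done (state-F₁ i)))
          (over 0ℚ (proj₁ at-F₁ i∈) (p≤D i) (0+ D≤x))

      at-X₃ : (∀ {i} → i ∈ X → X₃.at i ≤ y + loadBefore X q i) × proj₁ rX₃ ≤ y + ∑[ X ] q
      at-X₃ = X₃.punctual (≤-trans (proj₂ at-Y₃) (0+ p≤p⊔q (∑[ Y ] q) D))
        λ {i} i∈ → subst (_≤ y + loadBefore X q i) (sym (cong done (state-X₂ i∈)))
          (over 0ℚ (proj₁ at-X₂ i∈) (q≤D i) (0+ D≤y))

      at-Y₁ : (∀ {i} → i ∈ Y → Y₁.at i ≤ P + loadBefore Y q i) × proj₁ rY₁ ≤ P + ∑[ Y ] q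
      at-Y₁ = Y₁.punctual (≤-trans (proj₂ at-F₁) (0+ ≤-reflexive sum-F))
        λ {i} i∈ → subst (_≤ P + loadBefore Y q i) (sym (cong done (state-Y₃ i∈)))
          (over 0ℚ (proj₁ at-Y₃ i∈) (q≤D i) (0+ D≤P))

      end-F₃ : proj₁ rF₃ ≤ (x + y) + ∑[ F ] p
      end-F₃ = proj₂ (F₃.punctual
        (≤-trans (proj₂ at-X₃) (≤-trans (≤-reflexive (+-comm y _)) (+-monoˡ-≤ y (p≤p⊔q (∑[ X ] q) D))))
        λ {i} i∈ → subst (_≤ (x + y) + loadBefore F p i) (sym (cong done (state-F₂ i)))
          (over x (proj₁ at-F₂ i∈) (p≤D i) (+-monoʳ-≤ x D≤y)))

      end-X₁ : proj₁ rX₁ ≤ (P + y) + ∑[ X ] q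
      end-X₁ = proj₂ (X₁.punctual (≤-trans (proj₂ at-Y₁) (+-monoʳ-≤ P (p≤p⊔q (∑[ Y ] q) D)))
        λ {i} i∈ → subst (_≤ (P + y) + loadBefore X q i) (sym (cong done (state-X₃ i∈)))
          (over y (proj₁ at-X₃ i∈) (q≤D i) (≤-trans (≤-reflexive (+-comm y D)) (+-monoˡ-≤ y D≤P))))

      end-Y₂ : proj₁ rY₂ ≤ (P + x) + ∑[ Y ] q
      end-Y₂ = proj₂ (Y₂.punctual
        (≤-trans (proj₂ at-F₂) (≤-reflexive (trans (cong (x +_) sum-F) (+-comm x P))))
        λ {i} i∈ → subst (_≤ (P + x) + loadBefore Y q i) (sym (cong done (state-Y₁ i∈)))
          (over P (proj₁ at-Y₁ i∈) (q≤D i) (+-monoʳ-≤ P D≤x)))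

      W : ℚ
      W = P + (x + y)

      F₃≤W : proj₁ rF₃ ≤ W
      F₃≤W = ≤-trans end-F₃ (≤-reflexive (trans (cong ((x + y) +_) sum-F) (+-comm (x + y) P)))

      X₁≤W : proj₁ rX₁ ≤ W
      X₁≤W = begin
        proj₁ rX₁             ≤⟨ end-X₁ ⟩
        (P + y) + ∑[ X ] q    ≤⟨ +-monoʳ-≤ (P + y) (p≤p⊔q (∑[ X ] q) D) ⟩
        (P + y) + x           ≡⟨ solve 3 (λ P x y → (P :+ y) :+ x := P :+ (x :+ y)) refl P x y ⟩
        W                     ∎

      Y₂≤W : proj₁ rY₂ ≤ W
      Y₂≤W = begin
        proj₁ rY₂             ≤⟨ end-Y₂ ⟩
        (P + x) + ∑[ Y ] q    ≤⟨ +-monoʳ-≤ (P + x) (p≤p⊔q (∑[ Y ] q) D) ⟩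
        (P + x) + y           ≡⟨ +-assoc P x y ⟩
        W                     ∎

      hi≤W : ∀ M K → hi M K ≤ W
      hi≤W M₁ 𝓕 = ≤-trans Y₁.t≤end (≤-trans X₁.t≤end X₁≤W)
      hi≤W M₁ 𝓨 = ≤-trans X₁.t≤end X₁≤W
      hi≤W M₁ 𝓧 = X₁≤W
      hi≤W M₂ 𝓧 = ≤-trans F₂.t≤end (≤-trans Y₂.t≤end Y₂≤W)
      hi≤W M₂ 𝓕 = ≤-trans Y₂.t≤end Y₂≤W
      hi≤W M₂ 𝓨 = Y₂≤W
      hi≤W M₃ 𝓨 = ≤-trans X₃.t≤end (≤-trans F₃.t≤end F₃≤W)
      hi≤W M₃ 𝓧 = ≤-trans F₃.t≤end F₃≤W
      hi≤W M₃ 𝓕 = F₃≤W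

    makespan-bound : makespan I σ ≤ ∑[ ⊤ ] p + ((∑[ X ] q ⊔ D) + (∑[ Y ] q ⊔ D))
    makespan-bound = makespan≤ I σ (≤-trans (0≤lo M₂ 𝓕) (≤-trans F₂.t≤end (hi≤W M₂ 𝓕)))
      λ j M → let K , k = class j in
        subst (λ s → s + duration I j ≤ W) (sym (start≡slot k M))
          (≤-trans (proj₂ (window k M)) (hi≤W M K))

-- Choosing between two bipartitions

∑-∁ : ∀ {k} (S : Subset k) (d : Vec ℚ k) → ∑[ S ] d + ∑[ ∁ S ] d ≡ ∑[ ⊤ ] d
∑-∁ []            []      = refl
∑-∁ (inside ∷ S)  (x ∷ d) = trans (+-assoc x _ _) (cong (x +_) (∑-∁ S d))
∑-∁ (outside ∷ S) (x ∷ d) = trans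
  (solve 3 (λ s x t → s :+ (x :+ t) := x :+ (s :+ t)) refl (∑[ S ] d) x (∑[ ∁ S ] d))
  (cong (x +_) (∑-∁ S d))

decreasing⇒≤head : ∀ {k} (d : Vec ℚ (suc k)) → Linked _≥_ d → All (_≤ head d) d
decreasing⇒≤head (x ∷ d) sorted = Linked⇒All {R = _≥_} (flip ≤-trans) ≤-refl sorted

headAtMost⇒All : ∀ {k c} (d : Vec ℚ k) → HeadAtMost c d → Linked _≥_ d → All (_≤ c) d
headAtMost⇒All []      _   _      = []
headAtMost⇒All (x ∷ d) x≤c sorted = Linked⇒All {R = _≥_} (flip ≤-trans) x≤c sorted

module Choice (D ε : ℚ) (0≤ε : 0ℚ ≤ ε) where

  g : ℚ → ℚ → ℚ
  g u v = (u ⊔ D) + (v ⊔ D)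

  private
    [1+ε]*_ : ∀ u → (1ℚ + ε) * u ≡ u + ε * u
    [1+ε]* u = trans (*-distribʳ-+ u 1ℚ ε) (cong (_+ ε * u) (*-identityˡ u))

    ε*-mono : ∀ {u v} → u ≤ v → ε * u ≤ ε * v
    ε*-mono = *-monoˡ-≤-nonNeg ε {{nonNegative 0≤ε}}

    0≤εx : ∀ {x} → 0ℚ ≤ x → 0ℚ ≤ ε * x
    0≤εx 0≤x = ≤-trans (≤-reflexive (sym (*-zeroʳ ε))) (ε*-mono 0≤x)

  -- If x ≤ D, moving from {y , x} to {b′ , b} loses at most ε x on the side of y.
  fitting-side : ∀ x y b b′ → 0ℚ ≤ x → x ≤ D → (1ℚ - ε) * x ≤ b → b ≤ D → b′ + b ≡ x + y →
                 g b′ b ≤ g x y + ε * x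
  fitting-side x y b b′ 0≤x x≤D near b≤D sum = begin
    (b′ ⊔ D) + (b ⊔ D)               ≤⟨ +-mono-≤ (⊔-lub b′≤ D≤) (⊔-lub (≤-trans b≤D D≤x⊔D) D≤x⊔D) ⟩
    ((y ⊔ D) + ε * x) + (x ⊔ D)      ≡⟨ solve 3 (λ y e x → (y :+ e) :+ x := (x :+ y) :+ e) refl
                                          (y ⊔ D) (ε * x) (x ⊔ D) ⟩
    g x y + ε * x                    ∎
    where
    D≤x⊔D : D ≤ x ⊔ D
    D≤x⊔D = p≤q⊔p x D
    D≤ : D ≤ (y ⊔ D) + ε * x
    D≤ = ≤-trans (p≤q⊔p y D) (p≤p+nonNeg (y ⊔ D) (0≤εx 0≤x))
    b′≤ : b′ ≤ (y ⊔ D) + ε * x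
    b′≤ = begin
      b′                                       ≡⟨ solve 2 (λ b′ b → b′ := (b′ :+ b) :- b) refl b′ b ⟩
      (b′ + b) - b                             ≡⟨ cong (_- b) sum ⟩
      (x + y) - b                              ≤⟨ +-monoʳ-≤ (x + y) (neg-antimono-≤ near) ⟩
      (x + y) - (1ℚ - ε) * x                   ≡⟨ solve 3 (λ x y ε → (x :+ y) :- ((con 1ℚ :- ε) :* x) := y :+ ε :* x)
                                                  refl x y ε ⟩
      y + ε * x                                ≤⟨ +-monoˡ-≤ (ε * x) (p≤p⊔q y D) ⟩
      (y ⊔ D) + ε * x                          ∎

  -- As `a` exceeds `D`, the value `g a a′` is the larger of `a + a′` and `a + D`. The first is the
  -- common total `x + y`; in the second, `D` is below `y` and `a` exceeds `x` by at most `ε * x`.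
  overfull-sides : ∀ x y a a′ → 0ℚ ≤ x → D < y → D < a → a ≤ (1ℚ + ε) * x → a + a′ ≡ x + y →
                   g a a′ ≤ g x y + ε * x
  overfull-sides x y a a′ 0≤x D<y D<a near sum = begin
    (a ⊔ D) + (a′ ⊔ D)      ≡⟨ cong (_+ (a′ ⊔ D)) (p≥q⇒p⊔q≡p (<⇒≤ D<a)) ⟩
    a + (a′ ⊔ D)            ≡⟨ mono-≤-distrib-⊔ (+-monoʳ-≤ a) a′ D ⟩
    (a + a′) ⊔ (a + D)      ≤⟨ ⊔-lub a+a′≤ a+D≤ ⟩
    g x y + ε * x           ∎
    where
    x+y≤ : x + y ≤ g x y
    x+y≤ = +-mono-≤ (p≤p⊔q x D) (p≤p⊔q y D)
    a+a′≤ : a + a′ ≤ g x y + ε * x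
    a+a′≤ = ≤-trans (≤-reflexive sum) (≤-trans x+y≤ (p≤p+nonNeg (g x y) (0≤εx 0≤x)))
    a+D≤ : a + D ≤ g x y + ε * x
    a+D≤ = begin
      a + D                ≤⟨ +-mono-≤ near (<⇒≤ D<y) ⟩
      (1ℚ + ε) * x + y     ≡⟨ solve 3 (λ x y ε → (con 1ℚ :+ ε) :* x :+ y := (x :+ y) :+ ε :* x) refl x y ε ⟩
      (x + y) + ε * x      ≤⟨ +-monoˡ-≤ (ε * x) x+y≤ ⟩
      g x y + ε * x        ∎

  -- As x is one of the loads in g x y, a loss of ε x is a relative loss of ε.
  relative-loss : ∀ x y P {w} → 0ℚ ≤ P → 0ℚ ≤ y → w ≤ g x y + ε * x → P + w ≤ (1ℚ + ε) * (P + g x y)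
  relative-loss x y P {w} 0≤P 0≤y w≤ = begin
    P + w                                ≤⟨ +-monoʳ-≤ P w≤ ⟩
    P + (g x y + ε * x)                  ≡⟨ +-assoc P (g x y) (ε * x) ⟨
    (P + g x y) + ε * x                  ≤⟨ +-monoʳ-≤ (P + g x y) (ε*-mono x≤) ⟩
    (P + g x y) + ε * (P + g x y)        ≡⟨ [1+ε]* (P + g x y) ⟨
    (1ℚ + ε) * (P + g x y)               ∎
    where
    x≤ : x ≤ P + g x y
    x≤ = begin
      x                          ≤⟨ p≤p⊔q x D ⟩
      x ⊔ D                      ≤⟨ p≤p+nonNeg (x ⊔ D) (≤-trans 0≤y (p≤p⊔q y D)) ⟩
      g x y                      ≡⟨ +-identityˡ (g x y) ⟨
      0ℚ + g x y                 ≤⟨ +-monoˡ-≤ (g x y) 0≤P ⟩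
      P + g x y                  ∎

  -- `a` and `a′` are the loads behind π¹, `b′` and `b` those behind π², and `w` is the makespan of
  -- the shorter schedule. The case `y ≤ D` is the case `x ≤ D` with the parts exchanged, as `g` is
  -- symmetric.
  choice : ∀ x y a a′ b b′ P {w} → 0ℚ ≤ P → 0ℚ ≤ x → 0ℚ ≤ y →
           a + a′ ≡ x + y → b′ + b ≡ x + y → D < a → b ≤ D →
           (D < x → a ≤ (1ℚ + ε) * x) → (x ≤ D → (1ℚ - ε) * x ≤ b) → (y ≤ D → (1ℚ - ε) * y ≤ b) →
           w ≤ P + g a a′ → w ≤ P + g b′ b → w ≤ (1ℚ + ε) * (P + g x y)
  choice x y a a′ b b′ P 0≤P 0≤x 0≤y sum-a sum-b D<a b≤D min max-x max-y w≤a w≤b with x ≤? D | y ≤? D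
  ... | yes x≤D | _ = ≤-trans w≤b (relative-loss x y P 0≤P 0≤y
    (fitting-side x y b b′ 0≤x x≤D (max-x x≤D) b≤D sum-b))
  ... | no _ | yes y≤D = ≤-trans w≤b (subst (λ h → P + g b′ b ≤ (1ℚ + ε) * (P + h)) (+-comm (y ⊔ D) (x ⊔ D))
    (relative-loss y x P 0≤P 0≤x
      (fitting-side y x b b′ 0≤y y≤D (max-y y≤D) b≤D (trans sum-b (+-comm x y)))))
  ... | no x≰D | no y≰D = ≤-trans w≤a (relative-loss x y P 0≤P 0≤y
    (overfull-sides x y a a′ 0≤x (≰⇒> y≰D) D<a (min (≰⇒> x≰D)) sum-a))

-- Algorithm A(ε)

-- With the predicate as an argument, the same case distinction serves feasibility, makespans and
-- costs.
if-elim : ∀ {A B : Set} (P : A → Set) (d : Dec B) {t e : A} →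
          (B → P t) → (¬ B → P e) → P (if does d then t else e)
if-elim P (yes b) Pt Pe = Pt b
if-elim P (no ¬b) Pt Pe = Pe ¬b

makespanₜ-makespan : ∀ {ℓ m} (I : Instance ℓ m) (σ : Schedule ℓ m) → value (makespanₜ I σ) ≡ makespan I σ
makespanₜ-makespan I (schedule φ ω) = cong₂ _⊔_ (maximum p φ) (maximum q ω)
  where
  open Instance I
  maximum : ∀ {k} (d : Vec ℚ k) (s : Vec (Vec ℚ 3) k) →
    value (foldₜ _⊔ₜ_ 0ℚ (value (zipWithₜ completionₜ d s)))
    ≡ foldr′ _⊔_ 0ℚ (tabulate λ i → let end = λ M → lookup (lookup s i) M + lookup d i in
                                     end M₁ ⊔ (end M₂ ⊔ end M₃))
  maximum []      []                        = refl
  maximum (x ∷ d) ((s₁ ∷ s₂ ∷ s₃ ∷ []) ∷ s) =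
    cong (((s₁ + x) ⊔ ((s₂ + x) ⊔ (s₃ + x))) ⊔_) (maximum d s)

foldₜ-∑ : ∀ {k} (d : Vec ℚ k) → value (foldₜ _+ₜ_ 0ℚ d) ≡ ∑[ ⊤ ] d
foldₜ-∑ []      = refl
foldₜ-∑ (x ∷ d) = cong (x +_) (foldₜ-∑ d)

knapsack-sizes : ∀ {m} (q : Vec ℚ m) →
                 map Item.profit (value (mapₜ (λ x → step (item x x)) q)) ≡ q
                 × map Item.size (value (mapₜ (λ x → step (item x x)) q)) ≡ q
knapsack-sizes []      = refl , refl
knapsack-sizes (x ∷ q) = let profits , sizes = knapsack-sizes q in cong (x ∷_) profits , cong (x ∷_) sizes

-- `K` is written exactly as `betterOfTwo` computes it, so the guarantees of the schemes apply to
-- its calls by definitional equality.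
module SizeEqualsProfit {m} (q : Vec ℚ m) (c : ℚ) where
  K : Knapsack m
  K = knapsack (value (mapₜ (λ x → step (item x x)) q)) c

  profit-K : ∀ S → profit K S ≡ ∑[ S ] q
  profit-K S = cong (∑[ S ]_) (proj₁ (knapsack-sizes q))

  size-K : ∀ S → size K S ≡ ∑[ S ] q
  size-K S = cong (∑[ S ]_) (proj₂ (knapsack-sizes q))

  nonNeg-K : All (0ℚ ≤_) q → 0ℚ ≤ c → NonNegKnapsack K
  nonNeg-K nonNeg 0≤c = items nonNeg , 0≤c
    where
    items : ∀ {k} {d : Vec ℚ k} → All (0ℚ ≤_) d →
      All (λ i → 0ℚ ≤ Item.profit i × 0ℚ ≤ Item.size i) (value (mapₜ (λ x → step (item x x)) d))
    items []       = []
    items (h ∷ hs) = (h , h) ∷ items hs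

  overfull : ¬ (value (foldₜ _+ₜ_ 0ℚ q) ≤ c) → capacity K < size K ⊤
  overfull Q≰c = subst (c <_) (trans (foldₜ-∑ q) (sym (size-K ⊤))) (≰⇒> Q≰c)

  -- The time bounds of the schemes are stated for at least one item. Without open-shop jobs the
  -- total load would be 0 and could not exceed `c`.
  nonEmpty : 0ℚ ≤ c → ¬ (value (foldₜ _+ₜ_ 0ℚ q) ≤ c) → ℕ.NonZero m
  nonEmpty 0≤c = length≢0 q
    where
    length≢0 : ∀ {k} (d : Vec ℚ k) → ¬ (value (foldₜ _+ₜ_ 0ℚ d) ≤ c) → ℕ.NonZero k
    length≢0 []      Q≰c = contradiction 0≤c Q≰c
    length≢0 (_ ∷ _) _   = _

module _ {ℓ m} (I : Instance (suc ℓ) m) where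
  open Instance I

  0≤p₁ : 0ℚ ≤ p₁ I
  0≤p₁ = subst (0ℚ ≤_) (sym (head≡lookup p)) (lookup⁺ p-nonNeg 0F)

  0≤∑q : ∀ S → 0ℚ ≤ ∑[ S ] q
  0≤∑q S = ∑-nonNeg S q (lookup⁺ q-nonNeg)

  0≤∑p : 0ℚ ≤ ∑[ ⊤ ] p
  0≤∑p = ∑-nonNeg ⊤ p (lookup⁺ p-nonNeg)

  p₁≤∑p : p₁ I ≤ ∑[ ⊤ ] p
  p₁≤∑p = head≤∑ p p-nonNeg
    where
    head≤∑ : ∀ {k} (d : Vec ℚ (suc k)) → All (0ℚ ≤_) d → head d ≤ ∑[ ⊤ ] d
    head≤∑ (x ∷ d) (_ ∷ nonNeg) = p≤p+nonNeg x (∑-nonNeg ⊤ d (lookup⁺ nonNeg))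

  module _ (dominant : FlowDominant I) where

    Achieves : ℚ → ℚ → Schedule (suc ℓ) m → Set
    Achieves x y σ = Feasible I σ × makespan I σ ≤ bipartitionBound I x y

    -- Sortedness and `FlowDominant` enter here: together they make `p₁ I` an upper bound on every
    -- length, the `D` of `makespan-bound`.
    proc-achieves : ∀ X Y → (∀ i → i ∈ X ⊎ i ∈ Y) → (∀ {i} → i ∈ X → i ∉ Y) →
                    Achieves (∑[ X ] q) (∑[ Y ] q) (value (Proc X Y I))
    proc-achieves X Y X∪Y X∩Y = feasible , makespan-bound
      (lookup⁺ (decreasing⇒≤head p p-sorted)) (lookup⁺ (headAtMost⇒All q dominant q-sorted)) p₁≤∑p
      where open ProcSpec X Y I (value (Proc X Y I)) (proc-runs X Y I) X∪Y X∩Y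

    ∈-or-∈∁ : ∀ (X : Subset m) i → i ∈ X ⊎ i ∈ ∁ X
    ∈-or-∈∁ X i with i ∈? X
    ... | yes i∈X = inj₁ i∈X
    ... | no  i∉X = inj₂ (x∉p⇒x∈∁p i∉X)

    proc-∁ : ∀ X → Achieves (∑[ X ] q) (∑[ ∁ X ] q) (value (Proc X (value (complementₜ X)) I))
    proc-∁ X = subst (λ Y → Achieves (∑[ X ] q) (∑[ ∁ X ] q) (value (Proc X Y I))) (sym (complementₜ-∁ X))
      (proc-achieves X (∁ X) (∈-or-∈∁ X) x∈p⇒x∉∁p)

    ∁-proc : ∀ Y → Achieves (∑[ ∁ Y ] q) (∑[ Y ] q) (value (Proc (value (complementₜ Y)) Y I))
    ∁-proc Y = subst (λ X → Achieves (∑[ ∁ Y ] q) (∑[ Y ] q) (value (Proc X Y I))) (sym (complementₜ-∁ Y))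
      (proc-achieves (∁ Y) Y (swap ∘ ∈-or-∈∁ Y) x∈∁p⇒x∉p)

module Approximation (minKnapsack maxKnapsack : KnapsackAlgorithm)
                     (isMin : IsMinKnapsackScheme minKnapsack) (isMax : IsMaxKnapsackScheme maxKnapsack)
                     (ε : ℚ) .{{_ : Positive ε}} {ℓ m} (I : Instance (suc ℓ) m) (dominant : FlowDominant I) where
  open Instance I
  open IsMinKnapsackScheme isMin
  open IsMaxKnapsackScheme isMax

  0≤ε : 0ℚ ≤ ε
  0≤ε = <⇒≤ (positive⁻¹ ε)

  -- The guarantee in terms of loads alone. It transfers to schedules because `lower-bound` finds,
  -- for every feasible one, such a pair whose bound is at most its makespan.
  Good : Schedule (suc ℓ) m → Set
  Good σ = Feasible I σ × (∀ X Y → ∑[ X ] q + ∑[ Y ] q ≡ ∑[ ⊤ ] q →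
                             makespan I σ ≤ (1ℚ + ε) * bipartitionBound I (∑[ X ] q) (∑[ Y ] q))

  good⇒approximation : ∀ {σ} → Good σ → IsApproximation I (1ℚ + ε) σ
  good⇒approximation {σ} (feasible , bound) = record
    { feasible       = feasible
    ; within-minimum = λ { _ ((τ , τ-feasible , refl) , _) → within τ τ-feasible }
    ; within-any     = within
    }
    where
    within : ∀ τ → Feasible I τ → makespan I σ ≤ (1ℚ + ε) * makespan I τ
    within τ τ-feasible = let X , Y , sum , lower = LowerBound.lower-bound I τ τ-feasible in
      ≤-trans (bound X Y sum)
        (*-monoˡ-≤-nonNeg (1ℚ + ε) {{nonNegative (+-mono-≤ (nonNegative⁻¹ 1ℚ) 0≤ε)}} lower)

  private
    D P : ℚ
    D = p₁ I
    P = ∑[ ⊤ ] p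

    ∑≤Q : ∀ S → ∑[ S ] q ≤ ∑[ ⊤ ] q
    ∑≤Q S = ≤-trans (p≤p+nonNeg (∑[ S ] q) (0≤∑q I (∁ S))) (≤-reflexive (∑-∁ S q))

  oneSchedule-good : value (foldₜ _+ₜ_ 0ℚ q) ≤ D → Good (value (oneSchedule minKnapsack maxKnapsack ε I))
  oneSchedule-good Q≤D = proj₁ achieved , λ X Y _ → ≤-trans (proj₂ achieved)
    -- Here both maxima of the schedule equal `D`, the least value that either can have, so there is
    -- no loss at all; the slack `ε * ∑[ X ] q` only brings this into the form that `relative-loss`
    -- takes.
    (Choice.relative-loss D ε 0≤ε (∑[ X ] q) (∑[ Y ] q) P (0≤∑p I) (0≤∑q I Y) (≤-trans
      (+-mono-≤ (≤-trans (fits O) (p≤q⊔p (∑[ X ] q) D)) (≤-trans (fits (∁ O)) (p≤q⊔p (∑[ Y ] q) D)))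
      (p≤p+nonNeg _ (0≤ε*∑ X))))
    where
    O = value (mapₜ (λ _ → step inside) q)
    achieved = proc-∁ I dominant O
    fits : ∀ S → ∑[ S ] q ⊔ D ≤ D
    fits S = ⊔-lub (≤-trans (∑≤Q S) (≤-trans (≤-reflexive (sym (foldₜ-∑ q))) Q≤D)) ≤-refl
    0≤ε*∑ : ∀ X → 0ℚ ≤ ε * ∑[ X ] q
    0≤ε*∑ X = ≤-trans (≤-reflexive (sym (*-zeroʳ ε))) (*-monoˡ-≤-nonNeg ε {{nonNegative 0≤ε}} (0≤∑q I X))

  betterOfTwo-good : ¬ (value (foldₜ _+ₜ_ 0ℚ q) ≤ D) → Good (value (betterOfTwo minKnapsack maxKnapsack ε I))
  betterOfTwo-good Q≰D = shorter-feasible , λ X Y sum →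
    Choice.choice D ε 0≤ε (∑[ X ] q) (∑[ Y ] q) (∑[ A ] q) (∑[ ∁ A ] q) (∑[ B ] q) (∑[ ∁ B ] q) P
      (0≤∑p I) (0≤∑q I X) (0≤∑q I Y) (trans (∑-∁ A q) (sym sum))
      (trans (trans (+-comm (∑[ ∁ B ] q) (∑[ B ] q)) (∑-∁ B q)) (sym sum)) D<A B≤D
      (near-min X) (near-max X) (near-max Y)
      (≤-trans (proj₁ shorter) (proj₂ achieved¹)) (≤-trans (proj₂ shorter) (proj₂ achieved²))
    where
    open SizeEqualsProfit q D
    A B : Subset m
    A = value (minKnapsack ε K)
    B = value (maxKnapsack ε K)
    π¹ π² π : Schedule (suc ℓ) m
    π¹ = value (Proc A (value (complementₜ A)) I)
    π² = value (Proc (value (complementₜ B)) B I)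
    π  = value (betterOfTwo minKnapsack maxKnapsack ε I)

    achieved¹ = proc-∁ I dominant A
    achieved² = ∁-proc I dominant B

    C¹≤?C² = value (makespanₜ I π¹) ≤? value (makespanₜ I π²)

    shorter-feasible : Feasible I π
    shorter-feasible = if-elim (Feasible I) C¹≤?C² (λ _ → proj₁ achieved¹) (λ _ → proj₁ achieved²)

    shorter : makespan I π ≤ makespan I π¹ × makespan I π ≤ makespan I π²
    shorter = if-elim (λ σ → makespan I σ ≤ makespan I π¹ × makespan I σ ≤ makespan I π²) C¹≤?C²
      (λ le → ≤-refl , subst₂ _≤_ (makespanₜ-makespan I π¹) (makespanₜ-makespan I π²) le)
      (λ ≰  → subst₂ _≤_ (makespanₜ-makespan I π²) (makespanₜ-makespan I π¹) (<⇒≤ (≰⇒> ≰)) , ≤-refl)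

    K-nonNeg : NonNegKnapsack K
    K-nonNeg = nonNeg-K q-nonNeg (0≤p₁ I)

    D<Q : capacity K < size K ⊤
    D<Q = overfull Q≰D

    D<A : D < ∑[ A ] q
    D<A = subst (D <_) (size-K A) (unpackable ε K K-nonNeg D<Q)

    B≤D : ∑[ B ] q ≤ D
    B≤D = subst (_≤ D) (size-K B) (packable ε K K-nonNeg)

    near-min : ∀ X → D < ∑[ X ] q → ∑[ A ] q ≤ (1ℚ + ε) * ∑[ X ] q
    near-min X D<X = subst₂ (λ a x → a ≤ (1ℚ + ε) * x) (profit-K A) (profit-K X)
      (near-minimum ε K K-nonNeg D<Q X (subst (D <_) (sym (size-K X)) D<X))

    near-max : ∀ Y → ∑[ Y ] q ≤ D → (1ℚ - ε) * ∑[ Y ] q ≤ ∑[ B ] q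
    near-max Y Y≤D = subst₂ (λ y b → (1ℚ - ε) * y ≤ b) (profit-K Y) (profit-K B)
      (near-maximum ε K K-nonNeg Y (subst (_≤ D) (sym (size-K Y)) Y≤D))

  algorithmA-good : Good (value (algorithmA minKnapsack maxKnapsack ε I))
  algorithmA-good = if-elim (Good ∘ value) (value (foldₜ _+ₜ_ 0ℚ q) ≤? p₁ I) oneSchedule-good betterOfTwo-good

-- Running time

private
  -- `fromℕ k` is normalised by a gcd that does not compute for a variable `k`, so the facts about
  -- `fromℕ` are checked on unnormalised fractions with denominator 1, stored as its predecessor 0.
  integral : ℕ → ℚᵘ.ℚᵘ
  integral k = ℚᵘ.mkℚᵘ (ℤ.+ k) 0

  toℚᵘ-fromℕ : ∀ k → toℚᵘ (fromℕ k) ℚᵘ.≃ integral k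
  toℚᵘ-fromℕ k = toℚᵘ-fromℚᵘ (integral k)

fromℕ-mono : ∀ {m n} → m ℕ.≤ n → fromℕ m ≤ fromℕ n
fromℕ-mono {m} {n} m≤n = toℚᵘ-cancel-≤
  (ℚᵘ.≤-respˡ-≃ (ℚᵘ.≃-sym (toℚᵘ-fromℕ m)) (ℚᵘ.≤-respʳ-≃ (ℚᵘ.≃-sym (toℚᵘ-fromℕ n))
    (ℚᵘ.*≤* (ℤ.*-monoʳ-≤-nonNeg (ℤ.+ 1) (ℤ.+≤+ m≤n)))))

fromℕ-+ : ∀ m n → fromℕ (m ℕ.+ n) ≡ fromℕ m + fromℕ n
fromℕ-+ m n = toℚᵘ-injective (begin-equality′
  toℚᵘ (fromℕ (m ℕ.+ n))              ≃⟨ toℚᵘ-fromℕ (m ℕ.+ n) ⟩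
  integral (m ℕ.+ n)
    ≃⟨ ℚᵘ.*≡* (cong (ℤ._* ℤ.+ 1) (cong₂ ℤ._+_ (ℤ.*-identityʳ (ℤ.+ m)) (ℤ.*-identityʳ (ℤ.+ n)))) ⟨
  integral m ℚᵘ.+ integral n          ≃⟨ ℚᵘ.+-cong (toℚᵘ-fromℕ m) (toℚᵘ-fromℕ n) ⟨
  toℚᵘ (fromℕ m) ℚᵘ.+ toℚᵘ (fromℕ n)  ≃⟨ toℚᵘ-homo-+ (fromℕ m) (fromℕ n) ⟨
  toℚᵘ (fromℕ m + fromℕ n)            ∎′)
  where open ℚᵘ.≤-Reasoning using (step-≃-⟩; step-≃-⟨) renaming (begin-equality_ to begin-equality′_; _∎ to _∎′)

fromℕ-* : ∀ m n → fromℕ (m ℕ.* n) ≡ fromℕ m * fromℕ n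
fromℕ-* m n = toℚᵘ-injective (begin-equality′
  toℚᵘ (fromℕ (m ℕ.* n))              ≃⟨ toℚᵘ-fromℕ (m ℕ.* n) ⟩
  integral (m ℕ.* n)                  ≃⟨ ℚᵘ.*≡* (cong (ℤ._* ℤ.+ 1) (ℤ.pos-* m n)) ⟩
  integral m ℚᵘ.* integral n          ≃⟨ ℚᵘ.*-cong (toℚᵘ-fromℕ m) (toℚᵘ-fromℕ n) ⟨
  toℚᵘ (fromℕ m) ℚᵘ.* toℚᵘ (fromℕ n)  ≃⟨ toℚᵘ-homo-* (fromℕ m) (fromℕ n) ⟨
  toℚᵘ (fromℕ m * fromℕ n)            ∎′)
  where open ℚᵘ.≤-Reasoning using (step-≃-⟩; step-≃-⟨) renaming (begin-equality_ to begin-equality′_; _∎ to _∎′)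

-- Growth of the time bound

module _ (ε : ℚ) .{{_ : Positive ε}} where
  private
    r : ℚ
    r = (1/ ε) {{pos⇒nonZero ε}}

    L : ℕ
    L = log ℤ.∣ ⌈ r ⌉ ∣

    instance
      r-nonNeg : NonNegative r
      r-nonNeg = pos⇒nonNeg r {{1/pos⇒pos ε}}

      L-nonNeg : NonNegative (fromℕ L)
      L-nonNeg = normalize-nonNeg L 1

      rr-nonNeg : NonNegative (r * r)
      rr-nonNeg = nonNeg*nonNeg⇒nonNeg r r

      rrL-nonNeg : NonNegative (r * r * fromℕ L)
      rrL-nonNeg = nonNeg*nonNeg⇒nonNeg (r * r) (fromℕ L)

  -- The schemes are charged in terms of the open-shop jobs only, whereas the final bound counts all
  -- jobs.
  timeBound-mono : ∀ {m n} → m ℕ.≤ n → timeBound m ε ≤ timeBound n ε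
  timeBound-mono {m} {n} m≤n = +-mono-≤
    (fromℕ-mono (ℕ.*-mono-≤ m≤n (ℕ.⊓-monoˡ-≤ L (ℕ.⊔-monoʳ-≤ 1 (⌈log₂⌉-mono-≤ m≤n)))))
    (*-monoˡ-≤-nonNeg (r * r * fromℕ L) (⊓-monoˡ-≤ (r * fromℕ L) (fromℕ-mono m≤n)))

  -- Both logarithms are at least 1, so the first summand alone reaches `n`. This absorbs every
  -- linear cost of the algorithm.
  n≤timeBound : ∀ n → fromℕ n ≤ timeBound n ε
  n≤timeBound n = begin
    fromℕ n                             ≤⟨ fromℕ-mono (ℕ.m≤m*n n (log n ℕ.⊓ L) {{ℕ.>-nonZero 1≤log}}) ⟩
    fromℕ (n ℕ.* (log n ℕ.⊓ L))         ≤⟨ p≤p+nonNeg _ (nonNegative⁻¹ _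
                                             {{nonNeg*nonNeg⇒nonNeg (r * r * fromℕ L) _ {{min-nonNeg}}}}) ⟩
    timeBound n ε                       ∎
    where
    1≤log : 1 ℕ.≤ log n ℕ.⊓ L
    1≤log = ℕ.⊓-glb (ℕ.m≤m⊔n 1 ⌈log₂ n ⌉) (ℕ.m≤m⊔n 1 ⌈log₂ ℤ.∣ ⌈ r ⌉ ∣ ⌉)
    min-nonNeg : NonNegative (fromℕ n ⊓ (r * fromℕ L))
    min-nonNeg = nonNegative (⊓-glb (nonNegative⁻¹ (fromℕ n) {{normalize-nonNeg n 1}})
      (nonNegative⁻¹ (r * fromℕ L) {{nonNeg*nonNeg⇒nonNeg r (fromℕ L)}}))

-- Costs of the timed traversals

private
  regroup : ∀ a b → a ℕ.+ ((1 ℕ.+ b) ℕ.+ 1) ≡ 1 ℕ.+ ((1 ℕ.+ a) ℕ.+ b)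
  regroup = solve-∀

  exchange : ∀ a b c → a ℕ.+ (b ℕ.+ c) ≡ b ℕ.+ (a ℕ.+ c)
  exchange = solve-∀

  collect : ∀ a b e f n → (a ℕ.* n ℕ.+ e) ℕ.+ (b ℕ.* n ℕ.+ f) ≡ (a ℕ.+ b) ℕ.* n ℕ.+ (e ℕ.+ f)
  collect = solve-∀

  -- Induction step shared by the traversals: an element costs at most `c` plus 1 for the step, and
  -- the leading 1 pays for the empty vector at the end.
  per-item : ∀ c k {x y} → x ℕ.≤ c → y ℕ.≤ 1 ℕ.+ k ℕ.* suc c → x ℕ.+ (y ℕ.+ 1) ℕ.≤ 1 ℕ.+ suc k ℕ.* suc c
  per-item c k {x} {y} x≤ y≤ = ℕ.≤-trans (ℕ.+-mono-≤ x≤ (ℕ.+-monoˡ-≤ 1 y≤))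
    (ℕ.≤-reflexive (regroup c (k ℕ.* suc c)))

mapₜ-cost : ∀ {A B : Set} {k} c (f : A → Timed B) → (∀ x → cost (f x) ℕ.≤ c) →
            (xs : Vec A k) → cost (mapₜ f xs) ℕ.≤ 1 ℕ.+ k ℕ.* suc c
mapₜ-cost c f f≤c [] = ℕ.≤-refl
mapₜ-cost {k = suc k} c f f≤c (x ∷ xs) = per-item c k (f≤c x) (mapₜ-cost c f f≤c xs)

zipWithₜ-cost : ∀ {A B C : Set} {k} c (f : A → B → Timed C) → (∀ x y → cost (f x y) ℕ.≤ c) →
                (xs : Vec A k) (ys : Vec B k) → cost (zipWithₜ f xs ys) ℕ.≤ 1 ℕ.+ k ℕ.* suc c
zipWithₜ-cost c f f≤c [] [] = ℕ.≤-refl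
zipWithₜ-cost {k = suc k} c f f≤c (x ∷ xs) (y ∷ ys) = per-item c k (f≤c x y) (zipWithₜ-cost c f f≤c xs ys)

foldₜ-cost : ∀ {A B : Set} {k} c (f : A → B → Timed B) e → (∀ x y → cost (f x y) ℕ.≤ c) →
             (xs : Vec A k) → cost (foldₜ f e xs) ℕ.≤ 1 ℕ.+ k ℕ.* suc c
foldₜ-cost c f e f≤c [] = ℕ.≤-refl
foldₜ-cost {k = suc k} c f e f≤c (x ∷ xs) = ℕ.≤-trans
  (ℕ.≤-reflexive (exchange (cost (foldₜ f e xs)) (cost (f x _)) 1))
  (per-item c k (f≤c x _) (foldₜ-cost c f e f≤c xs))

run-cost : ∀ {k} M (S : Subset k) t (js : Vec JobState k) → cost (run M S t js) ℕ.≤ 1 ℕ.+ k ℕ.* 4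
run-cost M [] t [] = ℕ.≤-refl
run-cost {suc k} M (outside ∷ S) t (j ∷ js) = per-item 3 k {0} ℕ.z≤n (run-cost M S t js)
run-cost {suc k} M (inside ∷ S) t (job d c s ∷ js) =
  -- The 3 stands for the maximum, the addition and the write.
  per-item 3 k {3} ℕ.≤-refl (run-cost M S _ js)

complementₜ-cost : ∀ {k} (S : Subset k) → cost (complementₜ S) ℕ.≤ 1 ℕ.+ k ℕ.* 2
complementₜ-cost S = mapₜ-cost 1 _ (λ { inside → ℕ.≤-refl ; outside → ℕ.≤-refl }) S

-- Total cost as a multiple of the number of jobs

module LinearCost (N : ℕ) (1≤N : 1 ℕ.≤ N) where

  -- e collects the costs of the knapsack algorithms.
  record Bounded (a e x : ℕ) : Set where
    constructor bounded
    field bound : x ℕ.≤ a ℕ.* N ℕ.+ e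

  -- The additive 1 is charged as one more multiple of `N`, which is why `c` becomes `suc c`.
  linear : ∀ {k x} c → x ℕ.≤ 1 ℕ.+ k ℕ.* c → k ℕ.≤ N → Bounded (suc c) 0 x
  linear {k} {x} c x≤ k≤N = bounded (ℕ.≤-trans x≤ (ℕ.≤-trans (ℕ.+-mono-≤ 1≤N (ℕ.*-monoˡ-≤ c k≤N))
    (ℕ.≤-reflexive (trans (cong (N ℕ.+_) (ℕ.*-comm N c)) (sym (ℕ.+-identityʳ _))))))

  constant : ∀ c → Bounded c 0 c
  constant c = bounded (ℕ.≤-trans (ℕ.m≤m*n c N {{ℕ.>-nonZero 1≤N}}) (ℕ.m≤m+n _ 0))

  external : ∀ {x e} → x ℕ.≤ e → Bounded 0 e x
  external = bounded

  infixr 5 _▹_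
  -- Associating to the right as nested uses of `_>>=_` do, a chain of bounds has the shape of the
  -- cost of a do block.
  _▹_ : ∀ {a b e f x y} → Bounded a e x → Bounded b f y → Bounded (a ℕ.+ b) (e ℕ.+ f) (x ℕ.+ y)
  _▹_ {a} {b} {e} {f} (bounded x≤) (bounded y≤) =
    bounded (ℕ.≤-trans (ℕ.+-mono-≤ x≤ y≤) (ℕ.≤-reflexive (collect a b e f N)))

  module _ {ℓ m} (I : Instance ℓ m) (ℓ≤N : ℓ ℕ.≤ N) (m≤N : m ℕ.≤ N) where
    open Instance I

    -- 61 = 5 · 3 + 9 · 5 + 1: five plain traversals, nine runs and the final construction.
    proc-cost : ∀ X Y → Bounded 61 0 (cost (Proc X Y I))
    proc-cost X Y =
        linear 2 (mapₜ-cost 1 _ (λ _ → ℕ.≤-refl) p) ℓ≤N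
      ▹ linear 2 (mapₜ-cost 1 _ (λ _ → ℕ.≤-refl) p) ℓ≤N
      ▹ linear 2 (mapₜ-cost 1 _ (λ _ → ℕ.≤-refl) q) m≤N
      ▹ linear 4 (run-cost M₁ F 0ℚ fs₀) ℓ≤N
      ▹ linear 4 (run-cost M₂ X 0ℚ os₀) m≤N
      ▹ linear 4 (run-cost M₃ Y 0ℚ (proj₂ rX₂)) m≤N
      ▹ linear 4 (run-cost M₂ F (proj₁ rX₂) (proj₂ rF₁)) ℓ≤N
      ▹ linear 4 (run-cost M₃ X (proj₁ rY₃) (proj₂ rY₃)) m≤N
      ▹ linear 4 (run-cost M₁ Y (proj₁ rF₁) (proj₂ rX₃)) m≤N
      ▹ linear 4 (run-cost M₃ F (proj₁ rX₃) (proj₂ rF₂)) ℓ≤N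
      ▹ linear 4 (run-cost M₁ X (proj₁ rY₁) (proj₂ rY₁)) m≤N
      ▹ linear 4 (run-cost M₂ Y (proj₁ rF₂) (proj₂ rX₁)) m≤N
      ▹ linear 2 (mapₜ-cost 1 _ (λ _ → ℕ.≤-refl) (proj₂ rF₃)) ℓ≤N
      ▹ linear 2 (mapₜ-cost 1 _ (λ _ → ℕ.≤-refl) (proj₂ rY₂)) m≤N
      ▹ constant 1
      where
      F = value (mapₜ (λ _ → step inside) p)
      fs₀ = value (initₜ p)
      os₀ = value (initₜ q)
      rF₁ = value (run M₁ F 0ℚ fs₀)
      rX₂ = value (run M₂ X 0ℚ os₀)
      rY₃ = value (run M₃ Y 0ℚ (proj₂ rX₂))
      rF₂ = value (run M₂ F (proj₁ rX₂) (proj₂ rF₁))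
      rX₃ = value (run M₃ X (proj₁ rY₃) (proj₂ rY₃))
      rY₁ = value (run M₁ Y (proj₁ rF₁) (proj₂ rX₃))
      rF₃ = value (run M₃ F (proj₁ rX₃) (proj₂ rF₂))
      rX₁ = value (run M₁ X (proj₁ rY₁) (proj₂ rY₁))
      rY₂ = value (run M₂ Y (proj₁ rF₂) (proj₂ rX₁))

    makespanₜ-cost : ∀ σ → Bounded 21 0 (cost (makespanₜ I σ))
    makespanₜ-cost (schedule φ ω) =
        linear 6 (zipWithₜ-cost 5 _ completionₜ-cost p φ) ℓ≤N
      ▹ linear 6 (zipWithₜ-cost 5 _ completionₜ-cost q ω) m≤N
      ▹ linear 2 (foldₜ-cost 1 _⊔ₜ_ 0ℚ (λ _ _ → ℕ.≤-refl) (value (zipWithₜ completionₜ p φ))) ℓ≤N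
      ▹ linear 2 (foldₜ-cost 1 _⊔ₜ_ 0ℚ (λ _ _ → ℕ.≤-refl) (value (zipWithₜ completionₜ q ω))) m≤N
      ▹ constant 1
      where
      completionₜ-cost : ∀ d s → cost (completionₜ d s) ℕ.≤ 5
      completionₜ-cost d (_ ∷ _ ∷ _ ∷ []) = ℕ.≤-refl

  module _ {ℓ m} (I : Instance (suc ℓ) m) (ℓ<N : suc ℓ ℕ.≤ N) (m≤N : m ℕ.≤ N)
           (minKnapsack maxKnapsack : KnapsackAlgorithm) (ε : ℚ) where
    open Instance I

    oneSchedule-cost : Bounded 67 0 (cost (oneSchedule minKnapsack maxKnapsack ε I))
    oneSchedule-cost =
        linear 2 (mapₜ-cost 1 _ (λ _ → ℕ.≤-refl) q) m≤N
      ▹ linear 2 (complementₜ-cost O) m≤N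
      ▹ proc-cost I ℓ<N m≤N O (value (complementₜ O))
      where O = value (mapₜ (λ _ → step inside) q)

    open SizeEqualsProfit q (p₁ I) using (K)

    -- 175 collects two calls of `Proc` (61 each), two makespans (21 each), three traversals (3
    -- each) and two single steps. `e ℕ.+ (f ℕ.+ 0)` is what the external parts of the chain compute
    -- to.
    betterOfTwo-cost : ∀ {e f} → cost (minKnapsack ε K) ℕ.≤ e → cost (maxKnapsack ε K) ℕ.≤ f →
                       Bounded 175 (e ℕ.+ (f ℕ.+ 0)) (cost (betterOfTwo minKnapsack maxKnapsack ε I))
    betterOfTwo-cost min≤ max≤ =
        linear 2 (mapₜ-cost 1 _ (λ _ → ℕ.≤-refl) q) m≤N
      ▹ constant 1
      ▹ external min≤
      ▹ linear 2 (complementₜ-cost A) m≤N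
      ▹ proc-cost I ℓ<N m≤N A A′
      ▹ external max≤
      ▹ linear 2 (complementₜ-cost B) m≤N
      ▹ proc-cost I ℓ<N m≤N B′ B
      ▹ makespanₜ-cost I ℓ<N m≤N (value (Proc A A′ I))
      ▹ makespanₜ-cost I ℓ<N m≤N (value (Proc B′ B I))
      ▹ constant 1
      where
      A = value (minKnapsack ε K)
      A′ = value (complementₜ A)
      B = value (maxKnapsack ε K)
      B′ = value (complementₜ B)

module RunningTime (minKnapsack maxKnapsack : KnapsackAlgorithm)
                   (isMin : IsMinKnapsackScheme minKnapsack) (isMax : IsMaxKnapsackScheme maxKnapsack) where
  private
    module Min = IsMinKnapsackScheme isMin
    module Max = IsMaxKnapsackScheme isMax

    -- The constants of the schemes may be negative.
    a b : ℚ
    a = proj₁ Min.running-time ⊔ 0ℚ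
    b = proj₁ Max.running-time ⊔ 0ℚ

    0≤a : 0ℚ ≤ a
    0≤a = p≤q⊔p (proj₁ Min.running-time) 0ℚ

    0≤b : 0ℚ ≤ b
    0≤b = p≤q⊔p (proj₁ Max.running-time) 0ℚ

  -- 179 is 175 for `betterOfTwo`, 3 for summing the open-shop lengths and 1 for the comparison with
  -- p₁; the other branch takes 71.
  constantFactor : ℚ
  constantFactor = fromℕ 179 + (a + b)

  module _ (ε : ℚ) .{{_ : Positive ε}} {ℓ m} (I : Instance (suc ℓ) m) where
    open Instance I
    open SizeEqualsProfit q (p₁ I)

    private
      N : ℕ
      N = suc ℓ +ℕ m

      T : ℚ
      T = timeBound N ε

      m≤N : m ℕ.≤ N
      m≤N = ℕ.m≤n+m m (suc ℓ)

      open LinearCost N (ℕ.s≤s ℕ.z≤n)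

      instance
        T-nonNeg : NonNegative T
        T-nonNeg = nonNegative (≤-trans (fromℕ-mono (ℕ.z≤n {N})) (n≤timeBound ε N))

      external-cost : ∀ {x} c → fromℕ x ≤ c * timeBound m ε → fromℕ x ≤ (c ⊔ 0ℚ) * T
      external-cost {x} c x≤ = begin
        fromℕ x                      ≤⟨ x≤ ⟩
        c * timeBound m ε            ≤⟨ *-monoʳ-≤-nonNeg (timeBound m ε) {{timeBound-nonNeg}} (p≤p⊔q c 0ℚ) ⟩
        (c ⊔ 0ℚ) * timeBound m ε     ≤⟨ *-monoˡ-≤-nonNeg (c ⊔ 0ℚ) {{nonNegative (p≤q⊔p c 0ℚ)}} (timeBound-mono ε m≤N) ⟩
        (c ⊔ 0ℚ) * T                 ∎
        where
        timeBound-nonNeg : NonNegative (timeBound m ε)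
        timeBound-nonNeg = nonNegative (≤-trans (fromℕ-mono (ℕ.z≤n {m})) (n≤timeBound ε m))

      within-bound : ∀ {k e x} → k ℕ.≤ 179 → Bounded k e x → fromℕ e ≤ (a + b) * T → fromℕ x ≤ constantFactor * T
      within-bound {k} {e} {x} k≤ (bounded x≤) e≤ = begin
        fromℕ x                              ≤⟨ fromℕ-mono x≤ ⟩
        fromℕ (k ℕ.* N +ℕ e)                 ≤⟨ fromℕ-mono (ℕ.+-monoˡ-≤ e (ℕ.*-monoˡ-≤ N k≤)) ⟩
        fromℕ (179 ℕ.* N +ℕ e)               ≡⟨ fromℕ-+ (179 ℕ.* N) e ⟩
        fromℕ (179 ℕ.* N) + fromℕ e          ≡⟨ cong (_+ fromℕ e) (fromℕ-* 179 N) ⟩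
        fromℕ 179 * fromℕ N + fromℕ e        ≤⟨ +-mono-≤ (*-monoˡ-≤-nonNeg (fromℕ 179) (n≤timeBound ε N)) e≤ ⟩
        fromℕ 179 * T + (a + b) * T          ≡⟨ *-distribʳ-+ T (fromℕ 179) (a + b) ⟨
        constantFactor * T                   ∎

      sum-cost : cost (foldₜ _+ₜ_ 0ℚ q) ℕ.≤ 1 +ℕ m ℕ.* 2
      sum-cost = foldₜ-cost 1 _+ₜ_ 0ℚ (λ _ _ → ℕ.≤-refl) q

      -- The predicate for `if-elim`: the bound on the cost of `algorithmA` with `t` in place of the
      -- chosen branch.
      Affordable : ∀ {A} → Timed A → Set
      Affordable t = fromℕ (cost (foldₜ _+ₜ_ 0ℚ q) +ℕ (1 +ℕ cost t)) ≤ constantFactor * T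

      one-affordable : Affordable (oneSchedule minKnapsack maxKnapsack ε I)
      one-affordable = within-bound {71} (ℕ.m≤m+n 71 108)
        (linear 2 sum-cost m≤N ▹ constant 1 ▹ oneSchedule-cost I (ℕ.m≤m+n (suc ℓ) m) m≤N minKnapsack maxKnapsack ε)
        (≤-trans (≤-reflexive (sym (*-zeroˡ T))) (*-monoʳ-≤-nonNeg T (+-mono-≤ 0≤a 0≤b)))

      better-affordable : ¬ (value (foldₜ _+ₜ_ 0ℚ q) ≤ p₁ I) → Affordable (betterOfTwo minKnapsack maxKnapsack ε I)
      better-affordable Q≰p₁ = within-bound {179} ℕ.≤-refl
        (linear 2 sum-cost m≤N ▹ constant 1 ▹
         betterOfTwo-cost I (ℕ.m≤m+n (suc ℓ) m) m≤N minKnapsack maxKnapsack ε {e} {f} ℕ.≤-refl ℕ.≤-refl)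
        (begin
          fromℕ (e +ℕ (f +ℕ 0))   ≡⟨ cong (λ z → fromℕ (e +ℕ z)) (ℕ.+-identityʳ f) ⟩
          fromℕ (e +ℕ f)          ≡⟨ fromℕ-+ e f ⟩
          fromℕ e + fromℕ f
            ≤⟨ +-mono-≤ (external-cost {e} (proj₁ Min.running-time)
                          (proj₂ Min.running-time ε {m} {{m≢0}} K K-nonNeg (overfull Q≰p₁)))
                        (external-cost {f} (proj₁ Max.running-time)
                          (proj₂ Max.running-time ε {m} {{m≢0}} K K-nonNeg)) ⟩
          a * T + b * T           ≡⟨ *-distribʳ-+ T a b ⟨
          (a + b) * T             ∎)
        where
        e f : ℕ
        e = cost (minKnapsack ε K)
        f = cost (maxKnapsack ε K)
        K-nonNeg : NonNegKnapsack K
        K-nonNeg = nonNeg-K q-nonNeg (0≤p₁ I)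
        m≢0 : ℕ.NonZero m
        m≢0 = nonEmpty (0≤p₁ I) Q≰p₁

    algorithmA-cost : fromℕ (cost (algorithmA minKnapsack maxKnapsack ε I)) ≤ constantFactor * timeBound N ε
    algorithmA-cost = if-elim Affordable (value (foldₜ _+ₜ_ 0ℚ q) ≤? p₁ I) (λ _ → one-affordable) better-affordable

theorem3p7 : (minKnapsack maxKnapsack : KnapsackAlgorithm) →
    IsMinKnapsackScheme minKnapsack →
    IsMaxKnapsackScheme maxKnapsack →
    (∃ λ (c : ℚ) →
    ∀ (ε : ℚ) .{{_ : Positive ε}} {ℓ m} (I : Instance (suc ℓ) m) →
    fromℕ (cost (algorithmA minKnapsack maxKnapsack ε I)) ≤ c * timeBound (suc ℓ +ℕ m) ε)
    ×
    (∀ (ε : ℚ) .{{_ : Positive ε}} {ℓ m} (I : Instance (suc ℓ) m) →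
    FlowDominant I →
    IsApproximation I (1ℚ + ε) (value (algorithmA minKnapsack maxKnapsack ε I)))
theorem3p7 minKnapsack maxKnapsack isMin isMax =
    (constantFactor , λ ε I → algorithmA-cost ε I)
  , λ ε I dominant → let open Approximation minKnapsack maxKnapsack isMin isMax ε I dominant in
      good⇒approximation algorithmA-good
  where open RunningTime minKnapsack maxKnapsack isMin isMax
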